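{- Let $n,t \ge 1$ be integers, and let $G$ be a simple graph on $n$ vertices such that no forest on $2t+1$ vertices is an induced subgraph of $G$. Then $|E(G)| \ge g(n,t)$. If equality holds and $n < 4t$, then every component of $G$ is a complete graph on $1$, $3$ or $4$ vertices. If equality holds and $n \ge 4t$, then $G \cong G_{n,t}$.
   Context: The function $g:\mathbb{N}\times\mathbb{N}\to\mathbb{N}$ is defined recursively by: $g(n,t) = 0$ for $n < 2t$; $g(n,t) = 3(n-2t)$ for $2t \le n \le 4t$; and $g(n,t) = g(n-1,t) + \lceil n/t \rceil - 1$ for $n > 4t$. $G_{n,t}$ denotes the graph on $n$ vertices which is a disjoint union of $t$ complete graphs whose numbers of vertices pairwise differ by at most one. -}

module Defs where

open import Level using (0ℓ)
open import Data.Bool using (Bool; true; false; if_then_else_)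
open import Data.Fin using (Fin; zero; suc; toℕ; fromℕ; inject₁; _<?_)
open import Data.Fin.Properties using (_≟_)
open import Data.Fin.Subset using (Subset; _∈_; Nonempty)
open import Data.List using (length; filter; cartesianProduct; allFin; tabulate)
open import Data.Nat using (ℕ; zero; suc; pred; _+_; _*_; _∸_; _≤_; _<ᵇ_; _≤ᵇ_; NonZero; z≤n; s≤s)
open import Data.Nat.DivMod using (_/_; _%_; m≡m%n+[m/n]*n; m%n<n)
open import Data.Nat.ListAction using (sum)
open import Data.Nat.Properties using (+-comm; *-comm; +-monoʳ-≤; m≤m+n; ≤-refl; ≤-trans; <⇒≤; ≤-reflexive)
open import Data.Nat.Tactic.RingSolver using (solve-∀)
open import Data.Product using (Σ; ∃; _×_; _,_; proj₁; proj₂)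
open import Function.Bundles using (_↔_; _⇔_; Inverse)
open import Function.Definitions using (Injective)
open import Relation.Binary.Core using (Rel)
open import Relation.Binary.Definitions using (Decidable; Symmetric; Irreflexive)
open import Relation.Binary.Construct.Closure.ReflexiveTransitive using (Star)
open import Relation.Binary.PropositionalEquality using (_≡_; _≢_; refl; sym; trans; cong; ≢-sym)
open import Relation.Nullary using (¬_; yes; no; ¬?; map′; _×-dec_)

record SimpleGraph (V : Set) : Set₁ where
  infix 4 _~_ _~?_
  field
    _~_    : Rel V 0ℓ
    _~?_   : Decidable _~_
    ~-sym  : Symmetric _~_
    ~-irr  : Irreflexive _≡_ _~_

∣E∣ : ∀ {n} → SimpleGraph (Fin n) → ℕ
∣E∣ {n} G = length (filter (λ (u , v) → (u <? v) ×-dec (u ~? v)) (cartesianProduct (allFin n) (allFin n)))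
  where open SimpleGraph G

infix 4 _≅_
_≅_ : ∀ {V W} → SimpleGraph V → SimpleGraph W → Set
_≅_ {V} {W} G H = Σ (V ↔ W) λ f → ∀ u v → (u G.~ v) ⇔ (Inverse.to f u H.~ Inverse.to f v)
  where
  module G = SimpleGraph G
  module H = SimpleGraph H

infix 8 _[_]
_[_] : ∀ {n} → SimpleGraph (Fin n) → (S : Subset n) → SimpleGraph (∃ λ v → v ∈ S)
G [ S ] = record
  { _~_   = λ u v → proj₁ u ~ proj₁ v
  ; _~?_  = λ u v → proj₁ u ~? proj₁ v
  ; ~-sym = ~-sym
  ; ~-irr = λ { refl → ~-irr refl }
  }
  where open SimpleGraph G

-- A cycle of length 3 + k is given by its distinct vertices c 0, …, c (2 + k) in cyclic order.
record Cycle {V : Set} (G : SimpleGraph V) : Set where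
  open SimpleGraph G
  field
    k        : ℕ
    c        : Fin (3 + k) → V
    distinct : Injective _≡_ _≡_ c
    step     : (i : Fin (2 + k)) → c (inject₁ i) ~ c (suc i)
    close    : c (fromℕ (2 + k)) ~ c zero

IsForest : ∀ {V} → SimpleGraph V → Set
IsForest G = ¬ Cycle G

-- C is the vertex set of a component: a class of the relation "joined by a path".
IsComponent : ∀ {n} → SimpleGraph (Fin n) → Subset n → Set
IsComponent G C = Nonempty C × (∀ u → u ∈ C → ∀ v → v ∈ C ⇔ Star _~_ u v)
  where open SimpleGraph G

K : (m : ℕ) → SimpleGraph (Fin m)
K m = record
  { _~_   = _≢_
  ; _~?_  = λ u v → ¬? (u ≟ v)
  ; ~-sym = ≢-sym
  ; ~-irr = λ p q → q p
  }

module _ {t : ℕ} {V : Fin t → Set} (H : (i : Fin t) → SimpleGraph (V i)) where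

  private module H i = SimpleGraph (H i)

  data ⨆-Adj : Rel (Σ (Fin t) V) 0ℓ where
    within : ∀ {i u v} → H._~_ i u v → ⨆-Adj (i , u) (i , v)

  ⨆ : SimpleGraph (Σ (Fin t) V)
  ⨆ = record
    { _~_   = ⨆-Adj
    ; _~?_  = dec
    ; ~-sym = λ { (within {i} p) → within (H.~-sym i p) }
    ; ~-irr = λ { refl (within {i} p) → H.~-irr i refl p }
    }
    where
    dec : Decidable ⨆-Adj
    dec (i , u) (j , v) with i ≟ j
    ... | no  i≢j  = no λ { (within _) → i≢j refl }
    ... | yes refl = map′ within (λ { (within p) → p }) (H._~?_ i u v)

-- Part sizes of G_{n,t}: the first n % t parts get one vertex more than the others.
extra : ℕ → ℕ → ℕ
extra r i = if i <ᵇ r then 1 else 0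

part : (n t : ℕ) .{{_ : NonZero t}} → Fin t → ℕ
part n t i = n / t + extra (n % t) (toℕ i)

G⟨_,_⟩ : (n t : ℕ) .{{_ : NonZero t}} → SimpleGraph (Σ (Fin t) λ i → Fin (part n t i))
G⟨ n , t ⟩ = ⨆ λ i → K (part n t i)

part-balanced : ∀ n t .{{_ : NonZero t}} (i j : Fin t) → part n t i ≤ suc (part n t j)
part-balanced n t i j = ≤-trans (+-monoʳ-≤ (n / t) (extra≤1 (toℕ i <ᵇ n % t)))
  (≤-trans (≤-reflexive (+-comm (n / t) 1)) (s≤s (m≤m+n (n / t) _)))
  where
  extra≤1 : (b : Bool) → (if b then 1 else 0) ≤ 1
  extra≤1 true  = ≤-refl
  extra≤1 false = z≤n

part-total : ∀ n t .{{_ : NonZero t}} → sum (tabulate (part n t)) ≡ n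
part-total n t = trans (total t (n % t) (<⇒≤ (m%n<n n t))) (trans (cong (n % t +_) (*-comm t q)) (sym (m≡m%n+[m/n]*n n t)))
  where
  q = n / t
  swap : ∀ a b c → a + 0 + (b + c) ≡ b + (a + c)
  swap = solve-∀
  swap′ : ∀ a b c → a + 1 + (b + c) ≡ suc b + (a + c)
  swap′ = solve-∀
  total : ∀ s r → r ≤ s → sum (tabulate {n = s} λ i → q + extra r (toℕ i)) ≡ r + s * q
  total zero    zero    _       = refl
  total (suc s) zero    _       = trans (cong (q + 0 +_) (total s zero z≤n)) (swap q 0 (s * q))
  total (suc s) (suc r) (s≤s p) = trans (cong (q + 1 +_) (total s r p)) (swap′ q r (s * q))

⌈_/_⌉ : (n t : ℕ) .{{_ : NonZero t}} → ℕ
⌈ n / t ⌉ = (n + pred t) / t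

-- Only t ≥ 1 is meaningful (⌈ n / t ⌉ occurs), and then 0 < 2t gives g 0 t = 0.
-- The two truncated subtractions never truncate in the branches where they occur.
g : (n t : ℕ) .{{_ : NonZero t}} → ℕ
g zero      t = 0
g n@(suc m) t =
  if n <ᵇ 2 * t then 0 else
  if n ≤ᵇ 4 * t then 3 * (n ∸ 2 * t) else
  g m t + ⌈ n / t ⌉ ∸ 1

{-# OPTIONS --safe #-}
module Submission where

-- Write q = 3 + p and let D be the sum of the degrees. Every graph has an induced forest F with
-- 4 q n ≤ q (q + 1) ∣F∣ + 2 D: delete a vertex of degree ≥ q, or put a vertex of degree ≤ 1 into F;
-- if all degrees lie in [2, q - 1], the inequality for q - 1 is stronger because D ≤ (q - 1) n, and a
-- 2-regular graph (q = 3) loses a vertex v while a neighbour of v goes into F. With ∣F∣ ≤ 2t and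
-- D = 2 ∣E∣, the value q = 3 gives the bound for n ≤ 4t, and q = ⌊n / t⌋ gives it for n ≥ 4t.
--
-- Equality makes the inequality tight for every F, and tightness is inherited along the same
-- deletions. Hence all degrees are q, q - 1 (or 0 if q = 3) and adjacency is transitive on distinct
-- vertices: a vertex of degree q has only neighbours of degree q, so for any a ~ b ~ c some vertex
-- of degree q outside {a, b, c} can be deleted; in the 2-regular case, deleting a and b leaves c
-- with degree 0 or 1, and 1 is not allowed, so a ~ c. The components are therefore complete, and
-- ∣E∣ determines how many there are of each size.

open import Defs
import Algebra.Properties.Semiring.Sum
open import Data.Bool using (Bool; true; false; if_then_else_)
open import Data.Fin as Fin using (Fin; zero; suc; toℕ; fromℕ; inject₁)
open import Data.Fin.Properties as Fin using (_≟_; any?)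
open import Data.Fin.Relation.Unary.Top using (view; ‵fromℕ; ‵inject₁)
open import Data.Fin.Subset using (Subset; ∣_∣; _∈_; _∉_; _⊆_; _⊂_; _∪_; _─_; _-_; ⁅_⁆; ⊥; ⊤)
open import Data.Fin.Subset.Induction using (⊂-wellFounded)
open import Data.Fin.Subset.Properties
open import Data.List as List using (List; []; _∷_)
open import Data.List.Properties using (map-tabulate; filter-++; length-++)
open import Data.Nat as ℕ using (ℕ; zero; suc; _+_; _*_; _≤_; _<_; NonZero; z≤n; s≤s; _≤?_; _<?_; _∸_; pred)
open import Data.Nat.Divisibility using (n∣m*n)
open import Data.Nat.DivMod using (_/_; _%_; +-distrib-/-∣ʳ; m<n⇒m/n≡0; m*n/n≡m; /-monoˡ-≤; m≡m%n+[m/n]*n; m%n<n)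
open import Data.Nat.ListAction using (sum)
open import Data.Nat.Properties hiding (_≟_)
open import Data.Nat.Tactic.RingSolver using (solve; solve-∀)
open import Data.Product using (Σ; ∃; ∃₂; _×_; _,_; proj₁; proj₂)
open import Data.Sum using (_⊎_; inj₁; inj₂; [_,_]′)
open import Data.Vec as Vec using (lookup; here; there)
open import Data.Vec.Properties using (lookup⇒[]=; []=⇒lookup; lookup∘tabulate)
open import Data.Vec.Properties.WithK using ([]=-irrelevant)
open import Function using (_∘_; mk↔ₛ′; mk⇔; Equivalence)
open import Induction.WellFounded using (Acc; acc)
open import Relation.Binary.Construct.Closure.ReflexiveTransitive using (Star; ε; _◅_)
open import Relation.Binary.Definitions using (tri<; tri≈; tri>)
open import Relation.Binary.PropositionalEquality using (_≡_; _≢_; refl; sym; trans; cong; cong₂; subst; subst₂; module ≡-Reasoning)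
open import Relation.Nullary using (¬_; ¬?; Dec; yes; no; does; contradiction)
open import Relation.Nullary.Decidable using (_×-dec_; _⊎-dec_; dec-true; dec-false)

-- Sums over vertices, indicators and sizes of subsets.

module Sums = Algebra.Properties.Semiring.Sum +-*-semiring

∑ : ∀ {n} → (Fin n → ℕ) → ℕ
∑ = Sums.sum

𝟙 : Bool → ℕ
𝟙 b = if b then 1 else 0

∑-mono : ∀ {n} {f g : Fin n → ℕ} → (∀ i → f i ≤ g i) → ∑ f ≤ ∑ g
∑-mono {zero}  f≤g = z≤n
∑-mono {suc n} f≤g = +-mono-≤ (f≤g zero) (∑-mono (f≤g ∘ suc))

∑-tight : ∀ {n} {f g : Fin n → ℕ} → (∀ i → f i ≤ g i) → ∑ g ≤ ∑ f → ∀ i → f i ≡ g i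
∑-tight {suc n} {f} {g} f≤g ∑g≤∑f zero =
  ≤-antisym (f≤g zero) (+-cancelʳ-≤ _ _ _ (≤-trans ∑g≤∑f (+-monoʳ-≤ (f zero) (∑-mono (f≤g ∘ suc)))))
∑-tight {suc n} {f} {g} f≤g ∑g≤∑f (suc i) =
  ∑-tight (f≤g ∘ suc) (+-cancelˡ-≤ _ _ _ (≤-trans ∑g≤∑f (+-monoˡ-≤ _ (f≤g zero)))) i

∑-zero : ∀ {n} {f : Fin n → ℕ} → (∀ i → f i ≡ 0) → ∑ f ≡ 0
∑-zero {n} f≡0 = trans (Sums.sum-cong-≗ f≡0) (Sums.sum-replicate-zero n)

∑-single : ∀ {n} (f : Fin n → ℕ) i → (∀ j → j ≢ i → f j ≡ 0) → ∑ f ≡ f i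
∑-single f zero    f≡0 = trans (cong (f zero +_) (∑-zero λ j → f≡0 (suc j) λ ())) (+-identityʳ _)
∑-single f (suc i) f≡0 =
  cong₂ _+_ (f≡0 zero λ ()) (∑-single (f ∘ suc) i λ j j≢i → f≡0 (suc j) λ { refl → j≢i refl })

χ : ∀ {n} → Subset n → Fin n → ℕ
χ S v = 𝟙 (lookup S v)

χ-∈ : ∀ {n} {S : Subset n} {v} → v ∈ S → χ S v ≡ 1
χ-∈ v∈S = cong 𝟙 ([]=⇒lookup v∈S)

χ-∉ : ∀ {n} {S : Subset n} {v} → v ∉ S → χ S v ≡ 0
χ-∉ {S = S} {v} v∉S with lookup S v in eq
... | true  = contradiction (lookup⇒[]= v S eq) v∉S
... | false = refl

∣∣≡∑χ : ∀ {n} (S : Subset n) → ∣ S ∣ ≡ ∑ (χ S)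
∣∣≡∑χ Vec.[]          = refl
∣∣≡∑χ (true  Vec.∷ S) = cong suc (∣∣≡∑χ S)
∣∣≡∑χ (false Vec.∷ S) = ∣∣≡∑χ S

∈─⇒∉ : ∀ {n} {S T : Subset n} {v} → v ∈ S ─ T → v ∉ T
∈─⇒∉ {S = _ Vec.∷ _} {false Vec.∷ _} {zero}  _           ()
∈─⇒∉ {S = _ Vec.∷ _} {true  Vec.∷ _} {zero}  ()
∈─⇒∉ {S = _ Vec.∷ _} {_ Vec.∷ _}     {suc v} (there v∈) (there v∈T) = ∈─⇒∉ v∈ v∈T

χ-─ : ∀ {n} {S T : Subset n} → T ⊆ S → ∀ v → χ S v ≡ χ (S ─ T) v + χ T v
χ-─ {S = S} {T} T⊆S v with v ∈? T | v ∈? S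
... | yes v∈T | _       = trans (χ-∈ (T⊆S v∈T)) (sym (cong₂ _+_ (χ-∉ λ v∈ → ∈─⇒∉ {S = S} v∈ v∈T) (χ-∈ v∈T)))
... | no  v∉T | yes v∈S = trans (χ-∈ v∈S) (sym (cong₂ _+_ (χ-∈ (x∈p∧x∉q⇒x∈p─q v∈S v∉T)) (χ-∉ v∉T)))
... | no  v∉T | no  v∉S = trans (χ-∉ v∉S) (sym (cong₂ _+_ (χ-∉ λ v∈ → v∉S (p─q⊆p S T v∈)) (χ-∉ v∉T)))

∑-─ : ∀ {n} {S T : Subset n} → T ⊆ S → (f : Fin n → ℕ) →
      ∑ (λ v → χ S v * f v) ≡ ∑ (λ v → χ (S ─ T) v * f v) + ∑ (λ v → χ T v * f v)
∑-─ {S = S} {T} T⊆S f =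
  trans (Sums.sum-cong-≗ λ v → trans (cong (_* f v) (χ-─ T⊆S v)) (*-distribʳ-+ (f v) (χ (S ─ T) v) (χ T v)))
        (Sums.∑-distrib-+ (λ v → χ (S ─ T) v * f v) _)

∑-⁅⁆ : ∀ {n} v (f : Fin n → ℕ) → ∑ (λ u → χ ⁅ v ⁆ u * f u) ≡ f v
∑-⁅⁆ v f = trans (∑-single _ v λ u u≢v → cong (_* f u) (χ-∉ (x≢y⇒x∉⁅y⁆ u≢v)))
                 (trans (cong (_* f v) (χ-∈ (x∈⁅x⁆ v))) (+-identityʳ _))

⁅⁆⊆ : ∀ {n} {S : Subset n} {v} → v ∈ S → ⁅ v ⁆ ⊆ S
⁅⁆⊆ {S = S} {v} v∈S u∈ = subst (_∈ S) (sym (x∈⁅y⁆⇒x≡y v u∈)) v∈S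

∑-remove : ∀ {n} {S : Subset n} {v} → v ∈ S → (f : Fin n → ℕ) →
           ∑ (λ u → χ S u * f u) ≡ ∑ (λ u → χ (S - v) u * f u) + f v
∑-remove {S = S} {v} v∈S f = trans (∑-─ (⁅⁆⊆ v∈S) f) (cong (∑ (λ u → χ (S - v) u * f u) +_) (∑-⁅⁆ v f))

∣─∣ : ∀ {n} {S T : Subset n} → T ⊆ S → ∣ S ∣ ≡ ∣ S ─ T ∣ + ∣ T ∣
∣─∣ {S = S} {T} T⊆S = begin
  ∣ S ∣                         ≡⟨ ∣∣≡∑χ S ⟩
  ∑ (χ S)                       ≡⟨ Sums.sum-cong-≗ (χ-─ T⊆S) ⟩
  ∑ (λ v → χ (S ─ T) v + χ T v) ≡⟨ Sums.∑-distrib-+ (χ (S ─ T)) (χ T) ⟩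
  ∑ (χ (S ─ T)) + ∑ (χ T)       ≡⟨ cong₂ _+_ (∣∣≡∑χ (S ─ T)) (∣∣≡∑χ T) ⟨
  ∣ S ─ T ∣ + ∣ T ∣             ∎
  where open ≡-Reasoning

∣-∣ : ∀ {n} {S : Subset n} {v} → v ∈ S → ∣ S ∣ ≡ suc ∣ S - v ∣
∣-∣ {S = S} {v} v∈S =
  trans (∣─∣ (⁅⁆⊆ v∈S)) (trans (cong (∣ S - v ∣ +_) (∣⁅x⁆∣≡1 v)) (+-comm _ 1))

∈-⇒≢ : ∀ {n} {S : Subset n} {u v} → u ∈ S - v → u ≢ v
∈-⇒≢ {S = S} {u} u∈ refl = ∈─⇒∉ {S = S} u∈ (x∈⁅x⁆ u)

-⊆ : ∀ {n} {S : Subset n} {v} → S - v ⊆ S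
-⊆ {S = S} {v} = p─q⊆p S ⁅ v ⁆

∣∪⁅⁆∣ : ∀ {n} {F : Subset n} {v} → v ∉ F → ∣ F ∪ ⁅ v ⁆ ∣ ≡ suc ∣ F ∣
∣∪⁅⁆∣ {F = F} {v} v∉F = trans (∣-∣ v∈) (cong suc (cong ∣_∣ (⊆-antisym ⊆F F⊆)))
  where
  v∈ : v ∈ F ∪ ⁅ v ⁆
  v∈ = x∈p∪q⁺ (inj₂ (x∈⁅x⁆ v))
  ⊆F : (F ∪ ⁅ v ⁆) - v ⊆ F
  ⊆F u∈ with x∈p∪q⁻ F ⁅ v ⁆ (-⊆ u∈)
  ... | inj₁ u∈F = u∈F
  ... | inj₂ u∈v = contradiction u∈v (∈─⇒∉ {S = F ∪ ⁅ v ⁆} u∈)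
  F⊆ : F ⊆ (F ∪ ⁅ v ⁆) - v
  F⊆ u∈F = x∈p∧x≢y⇒x∈p-y (x∈p∪q⁺ (inj₁ u∈F)) λ { refl → v∉F u∈F }

delete-∉ : ∀ {n} {S F : Subset n} {v} → F ⊆ S - v → v ∉ F
delete-∉ {S = S} F⊆ v∈F = ∈-⇒≢ {S = S} (F⊆ v∈F) refl

insert-⊆ : ∀ {n} {S F : Subset n} {v} → v ∈ S → F ⊆ S → F ∪ ⁅ v ⁆ ⊆ S
insert-⊆ {F = F} {v} v∈S F⊆S u∈ = [ F⊆S , ⁅⁆⊆ v∈S ]′ (x∈p∪q⁻ F ⁅ v ⁆ u∈)

-- Membership proofs are unique, so vertices of an induced subgraph may be compared in the whole
-- graph.
∃-≡ : ∀ {n} {T : Subset n} {x y : ∃ λ v → v ∈ T} → proj₁ x ≡ proj₁ y → x ≡ y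
∃-≡ {x = u , p} {_ , q} refl = cong (u ,_) ([]=-irrelevant p q)

-- Degrees inside a subset and induced forests.

module _ {n} (G : SimpleGraph (Fin n)) where
  open SimpleGraph G

  a : Fin n → Fin n → ℕ
  a u v = 𝟙 (does (u ~? v))

  a-yes : ∀ {u v} → u ~ v → a u v ≡ 1
  a-yes {u} {v} u~v = cong 𝟙 (dec-true (u ~? v) u~v)

  a-no : ∀ {u v} → ¬ u ~ v → a u v ≡ 0
  a-no {u} {v} u≁v = cong 𝟙 (dec-false (u ~? v) u≁v)

  a≤1 : ∀ u v → a u v ≤ 1
  a≤1 u v with does (u ~? v)
  ... | true  = ≤-refl
  ... | false = z≤n

  a-sym : ∀ u v → a u v ≡ a v u
  a-sym u v with u ~? v
  ... | yes u~v = sym (a-yes (~-sym u~v))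
  ... | no  u≁v = sym (a-no (u≁v ∘ ~-sym))

  -- The vertex `v` need not lie in `S`, so the same sum also counts the neighbours of a vertex that
  -- has just been deleted.
  deg : Subset n → Fin n → ℕ
  deg S v = ∑ λ u → χ S u * a u v

  degreeSum : Subset n → ℕ
  degreeSum S = ∑ λ v → χ S v * deg S v

  deg-remove : ∀ {S u} → u ∈ S → ∀ v → deg S v ≡ deg (S - u) v + a u v
  deg-remove {S} u∈S v = ∑-remove {S = S} u∈S λ u → a u v

  deg-remove-self : ∀ {S v} → v ∈ S → deg S v ≡ deg (S - v) v
  deg-remove-self {S} {v} v∈S =
    trans (deg-remove v∈S v) (trans (cong (deg (S - v) v +_) (a-no (~-irr refl))) (+-identityʳ _))

  -- The factor 2 arises because `v` takes away its own degree and one unit from each of its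
  -- neighbours in `S`.
  degreeSum-remove : ∀ {S v} → v ∈ S → degreeSum S ≡ degreeSum (S - v) + 2 * deg S v
  degreeSum-remove {S} {v} v∈S = begin
    degreeSum S
      ≡⟨ ∑-remove {S = S} v∈S (deg S) ⟩
    ∑ (λ w → χ T w * deg S w) + deg S v
      -- After `a-sym`, the terms `χ T w * a w v` sum to `deg T v` by definition.
      ≡⟨ cong (_+ deg S v) (Sums.sum-cong-≗ λ w →
           trans (cong (χ T w *_) (trans (deg-remove v∈S w) (cong (deg T w +_) (a-sym v w))))
                 (*-distribˡ-+ (χ T w) (deg T w) (a w v))) ⟩
    ∑ (λ w → χ T w * deg T w + χ T w * a w v) + deg S v
      ≡⟨ cong (_+ deg S v) (Sums.∑-distrib-+ (λ w → χ T w * deg T w) (λ w → χ T w * a w v)) ⟩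
    degreeSum T + deg T v + deg S v
      ≡⟨ cong (λ k → degreeSum T + k + deg S v) (deg-remove-self v∈S) ⟨
    degreeSum T + deg S v + deg S v
      ≡⟨ trans (+-assoc (degreeSum T) (deg S v) (deg S v)) (cong (λ k → degreeSum T + (deg S v + k)) (sym (+-identityʳ _))) ⟩
    degreeSum T + 2 * deg S v ∎
    where
    open ≡-Reasoning
    T = S - v

  χ*a : ∀ {S u v} → u ∈ S → u ~ v → χ S u * a u v ≡ 1
  χ*a u∈S u~v = cong₂ _*_ (χ-∈ u∈S) (a-yes u~v)

  deg≥1 : ∀ {S u v} → u ∈ S → u ~ v → 1 ≤ deg S v
  deg≥1 {S} {u} {v} u∈S u~v =
    ≤-trans (≤-trans (≤-reflexive (sym (a-yes u~v))) (m≤n+m (a u v) (deg (S - u) v))) (≤-reflexive (sym (deg-remove u∈S v)))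

  deg≥2 : ∀ {S u w v} → u ∈ S → w ∈ S → u ≢ w → u ~ v → w ~ v → 2 ≤ deg S v
  deg≥2 {S} {u} {w} {v} u∈S w∈S u≢w u~v w~v =
    ≤-trans (+-mono-≤ (deg≥1 (x∈p∧x≢y⇒x∈p-y w∈S (u≢w ∘ sym)) w~v) (≤-reflexive (sym (a-yes u~v))))
            (≤-reflexive (sym (deg-remove u∈S v)))

  1≤deg⇒neighbour : ∀ {S v} → 1 ≤ deg S v → ∃ λ u → u ∈ S × u ~ v
  1≤deg⇒neighbour {S} {v} 1≤d with any? (λ u → u ∈? S ×-dec u ~? v)
  ... | yes (u , u∈S , u~v) = u , u∈S , u~v
  ... | no  none = contradiction 1≤d (<⇒≱ (s≤s (≤-reflexive (∑-zero zero-term))))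
    where
    zero-term : ∀ u → χ S u * a u v ≡ 0
    zero-term u with u ∈? S | u ~? v
    ... | no u∉S  | _       = cong (_* _) (χ-∉ u∉S)
    ... | yes u∈S | yes u~v = contradiction (u , u∈S , u~v) none
    ... | yes _   | no u≁v  = *-zeroʳ (χ S u)

  term-≤ : ∀ {S : Subset n} {f g : Fin n → ℕ} → (∀ v → v ∈ S → f v ≤ g v) → ∀ v → χ S v * f v ≤ χ S v * g v
  term-≤ {S} f≤g v with v ∈? S
  ... | yes v∈S = *-monoʳ-≤ (χ S v) (f≤g v v∈S)
  ... | no  v∉S = ≤-trans (≤-reflexive (cong (_* _) (χ-∉ v∉S))) z≤n

  ∑χ-const : ∀ (S : Subset n) k → ∑ (λ v → χ S v * k) ≡ k * ∣ S ∣
  ∑χ-const S k = trans (sym (Sums.*-distribʳ-sum k (χ S))) (trans (cong (_* k) (sym (∣∣≡∑χ S))) (*-comm ∣ S ∣ k))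

  degreeSum-≤ : ∀ {S k} → (∀ v → v ∈ S → deg S v ≤ k) → degreeSum S ≤ k * ∣ S ∣
  degreeSum-≤ {S} {k} d≤k = ≤-trans (∑-mono (term-≤ {S} d≤k)) (≤-reflexive (∑χ-const S k))

  -- The terms `χ S v * deg S v` are bounded by `χ S v * k` one by one while the sums agree, so no
  -- term can be smaller.
  regular : ∀ {S k} → (∀ v → v ∈ S → deg S v ≤ k) → k * ∣ S ∣ ≤ degreeSum S → ∀ v → v ∈ S → deg S v ≡ k
  regular {S} {k} d≤k kS≤D v v∈S = begin
    deg S v          ≡⟨ +-identityʳ _ ⟨
    1 * deg S v      ≡⟨ cong (_* deg S v) (χ-∈ v∈S) ⟨
    χ S v * deg S v  ≡⟨ ∑-tight (term-≤ {S} d≤k) (≤-trans (≤-reflexive (∑χ-const S k)) kS≤D) v ⟩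
    χ S v * k        ≡⟨ cong (_* k) (χ-∈ v∈S) ⟩
    1 * k            ≡⟨ +-identityʳ k ⟩
    k                ∎
    where open ≡-Reasoning

  -- Only the cycles of `G [ T ]` have to lie in `S`, not `T` itself; this covers both passing to a
  -- subset and adding a vertex that lies on no cycle.
  IsForest-mono : ∀ {S T} → (∀ (C : Cycle (G [ T ])) i → proj₁ (Cycle.c C i) ∈ S) → IsForest (G [ S ]) → IsForest (G [ T ])
  IsForest-mono {S} inS forest C = forest record
    { k        = Cycle.k C
    ; c        = λ i → proj₁ (Cycle.c C i) , inS C i
    ; distinct = λ eq → Cycle.distinct C (∃-≡ (cong proj₁ eq))
    ; step     = Cycle.step C
    ; close    = Cycle.close C
    }

  IsForest-⊆ : ∀ {S T} → T ⊆ S → IsForest (G [ S ]) → IsForest (G [ T ])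
  IsForest-⊆ T⊆S = IsForest-mono λ C i → T⊆S (proj₂ (Cycle.c C i))

  IsForest-⊥ : IsForest (G [ ⊥ ])
  IsForest-⊥ C = ∉⊥ (proj₂ (Cycle.c C zero))

-- Cycles and insertion of a vertex into a forest.

inject₁²≢suc² : ∀ {k} (i : Fin k) → inject₁ (inject₁ i) ≢ suc (suc i)
inject₁²≢suc² (suc i) eq = inject₁²≢suc² i (Fin.suc-injective eq)

-- The cases are the first, the last and an inner vertex; the two neighbours differ because a cycle
-- has length at least 3.
cycle-neighbours : ∀ {V} {G : SimpleGraph V} (C : Cycle G) → let open SimpleGraph G; open Cycle C in
  ∀ i → ∃₂ λ j l → j ≢ l × c j ~ c i × c l ~ c i
cycle-neighbours {G = G} C zero = suc zero , fromℕ _ , (λ ()) , ~-sym (step zero) , close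
  where open SimpleGraph G; open Cycle C
cycle-neighbours {G = G} C (suc i) with view i
... | ‵fromℕ     = inject₁ (fromℕ _) , zero , (λ ()) , step _ , ~-sym close
  where open SimpleGraph G; open Cycle C
... | ‵inject₁ j = inject₁ (inject₁ j) , suc (suc j) , inject₁²≢suc² j , step _ , ~-sym (step (suc j))
  where open SimpleGraph G; open Cycle C

module _ {n} (G : SimpleGraph (Fin n)) where
  open SimpleGraph G

  -- A cycle through `v` would give `v` two distinct neighbours in `F`, hence in `S`.
  IsForest-insert : ∀ {S F v} → F ⊆ S → v ∉ F → deg G S v ≤ 1 → IsForest (G [ F ]) → IsForest (G [ F ∪ ⁅ v ⁆ ])
  IsForest-insert {S} {F} {v} F⊆S v∉F d≤1 = IsForest-mono G avoids
    where
    ∈-∪ : ∀ {u} → u ∈ F ∪ ⁅ v ⁆ → u ≢ v → u ∈ F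
    ∈-∪ u∈ u≢v = [ (λ u∈F → u∈F) , (λ u∈v → contradiction (x∈⁅y⁆⇒x≡y v u∈v) u≢v) ]′ (x∈p∪q⁻ F ⁅ v ⁆ u∈)

    avoids : (C : Cycle (G [ F ∪ ⁅ v ⁆ ])) → ∀ i → proj₁ (Cycle.c C i) ∈ F
    avoids C i with proj₁ (Cycle.c C i) ≟ v
    ... | no  ci≢v = ∈-∪ (proj₂ (Cycle.c C i)) ci≢v
    ... | yes ci≡v with j , l , j≢l , cj~ , cl~ ← cycle-neighbours C i =
      contradiction (deg≥2 G (inS j cj~) (inS l cl~) (j≢l ∘ distinct ∘ ∃-≡) (~v cj~) (~v cl~)) (<⇒≱ (s≤s d≤1))
      where
      open Cycle C
      ~v : ∀ {u} → u ~ proj₁ (c i) → u ~ v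
      ~v = subst (_ ~_) ci≡v
      inS : ∀ j → proj₁ (c j) ~ proj₁ (c i) → proj₁ (c j) ∈ S
      inS j cj~ = F⊆S (∈-∪ (proj₂ (c j)) λ eq → ~-irr eq (~v cj~))

-- Arithmetic of the weight inequality, with q = 3 + p.

-- A linear inequality x ≤ y from a consequence l ≤ r of the hypotheses: x - y = l - r - k.
lin : ∀ {l r x y} k → l ≤ r → x + r + k ≡ y + l → x ≤ y
lin {l} {r} {x} {y} k l≤r eq = +-cancelʳ-≤ r x y (≤-trans (m≤m+n (x + r) k) (≤-trans (≤-reflexive eq) (+-monoʳ-≤ y l≤r)))

infixl 6 _⊞_
infixl 7 _⊠_

_⊞_ : ∀ {l r l′ r′} → l ≤ r → l′ ≤ r′ → l + l′ ≤ r + r′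
_⊞_ = +-mono-≤

_⊠_ : ∀ k {l r} → l ≤ r → k * l ≤ k * r
k ⊠ l≤r = *-monoʳ-≤ k l≤r

weight-delete : ∀ p s d f k → 3 + p ≤ k → 4 * (3 + p) * s ≤ (3 + p) * (4 + p) * f + 2 * d →
                4 * (3 + p) * suc s ≤ (3 + p) * (4 + p) * f + 2 * (d + 2 * k)
weight-delete p s d f k q≤k h = lin 0 (4 ⊠ q≤k ⊞ h) (solve (p ∷ s ∷ d ∷ f ∷ k ∷ []))

-- The new forest vertex adds q (q + 1) on the right, which covers the 4 q on the left because q ≥
-- 3. The slack is q (q - 3) + 4 k, and it must vanish in the equality case.
weight-insert : ∀ p s d f k → 4 * (3 + p) * s ≤ (3 + p) * (4 + p) * f + 2 * d →
                4 * (3 + p) * suc s ≤ (3 + p) * (4 + p) * suc f + 2 * (d + 2 * k)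
weight-insert p s d f k h = lin (p * (3 + p) + 4 * k) h (solve (p ∷ s ∷ d ∷ f ∷ k ∷ []))

weight-forest : ∀ p s d f → d ≤ (3 + p) * s → 4 * (3 + p) * s ≤ (3 + p) * (4 + p) * f + 2 * d → 2 * s ≤ (4 + p) * f
weight-forest p s d f d≤ h = *-cancelˡ-≤ (3 + p) (lin 0 (h ⊞ 2 ⊠ d≤) (solve (p ∷ s ∷ d ∷ f ∷ [])))

-- From q to q + 1 the left side grows by 4 s and the right side by 2 (q + 1) f; `weight-forest`
-- compares the two.
weight-suc : ∀ p s d f → d ≤ (3 + p) * s → 4 * (3 + p) * s ≤ (3 + p) * (4 + p) * f + 2 * d →
             4 * (4 + p) * s ≤ (4 + p) * (5 + p) * f + 2 * d
weight-suc p s d f d≤ h = lin 0 (h ⊞ 2 ⊠ weight-forest p s d f d≤ h) (solve (p ∷ s ∷ d ∷ f ∷ []))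

-- Existence of large induced forests.

module _ {n} (G : SimpleGraph (Fin n)) where
  open SimpleGraph G

  deg-suc : ∀ {S u v} → u ∈ S → u ~ v → deg G S v ≡ suc (deg G (S - u) v)
  deg-suc {S} {u} {v} u∈S u~v =
    trans (deg-remove G {S} u∈S v) (trans (cong (deg G (S - u) v +_) (a-yes G u~v)) (+-comm _ 1))

  -- A vertex of degree d contributes (4 q - 2 d) / (q (q + 1)) to the required size of `F`. This is
  -- the line through the values of 2 / (d + 1) at d = q - 1 and d = q, so disjoint cliques on q and
  -- q + 1 vertices, each with two forest vertices, attain the bound.
  HeavyForest : ℕ → Subset n → Set
  HeavyForest p S = ∃ λ F → F ⊆ S × IsForest (G [ F ]) ×
    4 * (3 + p) * ∣ S ∣ ≤ (3 + p) * (4 + p) * ∣ F ∣ + 2 * degreeSum G S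

  LowDegrees : ℕ → Subset n → Set
  LowDegrees p S = (∀ v → v ∈ S → 2 ≤ deg G S v) × (∀ v → v ∈ S → deg G S v ≤ 2 + p)

  heavyForest-insert : ∀ p {S v} → v ∈ S → deg G S v ≤ 1 → HeavyForest p (S - v) → HeavyForest p S
  heavyForest-insert p {S} {v} v∈S d≤1 (F , F⊆ , forest , bound) =
    F ∪ ⁅ v ⁆ , insert-⊆ v∈S (-⊆ {S = S} ∘ F⊆) , IsForest-insert G (-⊆ {S = S} ∘ F⊆) v∉F d≤1 forest ,
    subst₂ _≤_ (cong (4 * (3 + p) *_) (sym (∣-∣ v∈S)))
               (cong₂ (λ f d → (3 + p) * (4 + p) * f + 2 * d) (sym (∣∪⁅⁆∣ v∉F)) (sym (degreeSum-remove G v∈S)))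
               (weight-insert p (∣ S - v ∣) (degreeSum G (S - v)) (∣ F ∣) (deg G S v) bound)
    where
    v∉F : v ∉ F
    v∉F = delete-∉ {S = S} F⊆

  heavyForest-delete : ∀ p {S v} → v ∈ S → 3 + p ≤ deg G S v → HeavyForest p (S - v) → HeavyForest p S
  heavyForest-delete p {S} {v} v∈S q≤d (F , F⊆ , forest , bound) =
    F , -⊆ {S = S} ∘ F⊆ , forest ,
    subst₂ _≤_ (cong (4 * (3 + p) *_) (sym (∣-∣ v∈S)))
               (cong (λ d → (3 + p) * (4 + p) * ∣ F ∣ + 2 * d) (sym (degreeSum-remove G v∈S)))
               (weight-delete p (∣ S - v ∣) (degreeSum G (S - v)) (∣ F ∣) (deg G S v) q≤d bound)

  heavyForest-suc : ∀ p {S} → LowDegrees (suc p) S → HeavyForest p S → HeavyForest (suc p) S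
  heavyForest-suc p {S} (_ , d≤) (F , F⊆S , forest , bound) =
    F , F⊆S , forest , weight-suc p (∣ S ∣) (degreeSum G S) (∣ F ∣) (degreeSum-≤ G d≤) bound

  module DeleteEdge {S u v} (2≤d : ∀ w → w ∈ S → 2 ≤ deg G S w) (d≤2 : ∀ w → w ∈ S → deg G S w ≤ 2)
                    (v∈S : v ∈ S) (u∈S : u ∈ S) (u~v : u ~ v) where

    deg≡2 : ∀ {w} → w ∈ S → deg G S w ≡ 2
    deg≡2 {w} w∈S = ≤-antisym (d≤2 w w∈S) (2≤d w w∈S)

    u∈S-v : u ∈ S - v
    u∈S-v = x∈p∧x≢y⇒x∈p-y u∈S λ u≡v → ~-irr u≡v u~v

    deg-u≡1 : deg G (S - v) u ≡ 1
    deg-u≡1 = suc-injective (trans (sym (deg-suc v∈S (~-sym u~v))) (deg≡2 u∈S))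

    size : ∣ S ∣ ≡ 2 + ∣ S - v - u ∣
    size = trans (∣-∣ v∈S) (cong suc (∣-∣ u∈S-v))

    -- Deleting `v` costs 2 · 2; its neighbour `u` then has degree 1 and costs 2 · 1.
    degreeSum-S : degreeSum G S ≡ degreeSum G (S - v - u) + 6
    degreeSum-S = trans (degreeSum-remove G v∈S) (trans (cong₂ (λ d k → d + 2 * k)
      (trans (degreeSum-remove G u∈S-v) (cong (λ k → degreeSum G (S - v - u) + 2 * k) deg-u≡1)) (deg≡2 v∈S))
      (+-assoc (degreeSum G (S - v - u)) 2 4))

    ⊂S : S - v - u ⊂ S
    ⊂S = ⊂-trans (x∈p⇒p-x⊂p u∈S-v) (x∈p⇒p-x⊂p v∈S)

  -- Both sides grow by 24: two vertices on the left, and on the right one forest vertex for 12 and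
  -- a degree sum larger by 6, counted twice.
  heavyForest-2-regular : ∀ {S} → (∀ T → T ⊂ S → HeavyForest 0 T) → LowDegrees 0 S → HeavyForest 0 S
  heavyForest-2-regular {S} rec (2≤d , d≤2) with nonempty? S
  ... | no empty = ⊥ , ⊥⊆ , IsForest-⊥ G ,
        ≤-trans (≤-reflexive (trans (cong (12 *_) (trans (cong ∣_∣ (Empty-unique empty)) (∣⊥∣≡0 n))) (*-zeroʳ 12))) z≤n
  ... | yes (v , v∈S)
      with u , u∈S , u~v ← 1≤deg⇒neighbour G {S} {v} (<⇒≤ (2≤d v v∈S))
      with F , F⊆ , forest , bound ← rec (S - v - u) (DeleteEdge.⊂S 2≤d d≤2 v∈S u∈S u~v) =
    -- Once `v` is discarded, `u` has degree 1 and can join `F` without closing a cycle.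
    F ∪ ⁅ u ⁆ , insert-⊆ u∈S (-⊆ {S = S} ∘ -⊆ {S = S - v} ∘ F⊆) , IsForest-insert G {S - v} (-⊆ {S = S - v} ∘ F⊆) u∉F (≤-reflexive deg-u≡1) forest ,
    subst₂ _≤_ (cong (12 *_) (sym size))
               (cong₂ (λ f d → 12 * f + 2 * d) (sym (∣∪⁅⁆∣ u∉F)) (sym degreeSum-S))
               (weight-insert-delete (∣ S - v - u ∣) (degreeSum G (S - v - u)) (∣ F ∣) bound)
    where
    open DeleteEdge 2≤d d≤2 v∈S u∈S u~v
    u∉F : u ∉ F
    u∉F = delete-∉ {S = S - v} F⊆
    weight-insert-delete : ∀ s d f → 12 * s ≤ 12 * f + 2 * d → 12 * (2 + s) ≤ 12 * suc f + 2 * (d + 6)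
    weight-insert-delete s d f h = lin 0 h (solve (s ∷ d ∷ f ∷ []))

  -- The argument `low` handles the sets with all degrees in [2, q - 1], the only case in which q =
  -- 3 and q > 3 are treated differently.
  heavyForest-induction : ∀ p → (∀ S → (∀ T → T ⊂ S → HeavyForest p T) → LowDegrees p S → HeavyForest p S) →
                          ∀ S → Acc _⊂_ S → HeavyForest p S
  heavyForest-induction p low S (acc rs) with any? (λ v → v ∈? S ×-dec deg G S v ≤? 1)
  ... | yes (v , v∈S , d≤1) =
    heavyForest-insert p v∈S d≤1 (heavyForest-induction p low (S - v) (rs (x∈p⇒p-x⊂p v∈S)))
  ... | no d≰1 with any? (λ v → v ∈? S ×-dec 3 + p ≤? deg G S v)
  ...   | yes (v , v∈S , q≤d) =
    heavyForest-delete p v∈S q≤d (heavyForest-induction p low (S - v) (rs (x∈p⇒p-x⊂p v∈S)))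
  ...   | no q≰d = low S (λ T T⊂S → heavyForest-induction p low T (rs T⊂S))
    ((λ v v∈S → ≰⇒> λ d≤1 → d≰1 (v , v∈S , d≤1)) , λ v v∈S → ≤-pred (≰⇒> λ q≤d → q≰d (v , v∈S , q≤d)))

  heavyForest : ∀ p S → HeavyForest p S
  heavyForest zero    S = heavyForest-induction 0 (λ _ → heavyForest-2-regular) S (⊂-wellFounded S)
  heavyForest (suc p) S =
    -- The low case keeps the set `T` and lowers q, so an outer recursion on `p` encloses the
    -- induction on subsets.
    heavyForest-induction (suc p) (λ T _ low → heavyForest-suc p low (heavyForest p T)) S (⊂-wellFounded S)

-- Arithmetic of the equality case.

tight-weight-delete : ∀ p s d f k → 3 + p ≤ k → (3 + p) * (4 + p) * f + 2 * (d + 2 * k) ≤ 4 * (3 + p) * suc s →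
                      (3 + p) * (4 + p) * f + 2 * d ≤ 4 * (3 + p) * s
tight-weight-delete p s d f k q≤k h = lin 0 (4 ⊠ q≤k ⊞ h) (solve (p ∷ s ∷ d ∷ f ∷ k ∷ []))

tight-weight-degree : ∀ p s d f k → 4 * (3 + p) * s ≤ (3 + p) * (4 + p) * f + 2 * d →
                      (3 + p) * (4 + p) * f + 2 * (d + 2 * k) ≤ 4 * (3 + p) * suc s → k ≤ 3 + p
tight-weight-degree p s d f k h h′ = *-cancelˡ-≤ 4 (lin 0 (h ⊞ h′) (solve (p ∷ s ∷ d ∷ f ∷ k ∷ [])))

tight-weight-leaf : ∀ p s d f k → 4 * (3 + p) * s ≤ (3 + p) * (4 + p) * f + 2 * d →
                    (3 + p) * (4 + p) * suc f + 2 * (d + 2 * k) ≤ 4 * (3 + p) * suc s → p * (3 + p) + 4 * k ≤ 0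
tight-weight-leaf p s d f k h h′ = lin 0 (h ⊞ h′) (solve (p ∷ s ∷ d ∷ f ∷ k ∷ []))

-- The bound for q and tightness for q + 1 together leave (q + 1) f ≤ 2 s; putting this back into
-- the bound for q gives q s ≤ d.
tight-weight-regular : ∀ p s d f → 4 * (3 + p) * s ≤ (3 + p) * (4 + p) * f + 2 * d →
                       (4 + p) * (5 + p) * f + 2 * d ≤ 4 * (4 + p) * s → (3 + p) * s ≤ d
tight-weight-regular p s d f h h′ =
  *-cancelˡ-≤ 2 (lin 0 (h ⊞ (3 + p) ⊠ f≤) (solve (p ∷ s ∷ d ∷ f ∷ [])))
  where
  f≤ : (4 + p) * f ≤ 2 * s
  f≤ = *-cancelˡ-≤ 2 (lin 0 (h ⊞ h′) (solve (p ∷ s ∷ d ∷ f ∷ [])))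

-- When d = q s, tightness for q + 1 and tightness for q both amount to (q + 1) f ≤ 2 s.
tight-weight-pred : ∀ p s d f → d ≤ (3 + p) * s → (3 + p) * s ≤ d →
                    (4 + p) * (5 + p) * f + 2 * d ≤ 4 * (4 + p) * s → (3 + p) * (4 + p) * f + 2 * d ≤ 4 * (3 + p) * s
tight-weight-pred p s d f d≤ ≤d h = lin 0 ((3 + p) ⊠ f≤ ⊞ 2 ⊠ d≤) (solve (p ∷ s ∷ d ∷ f ∷ []))
  where
  f≤ : (4 + p) * f ≤ 2 * s
  f≤ = *-cancelˡ-≤ (5 + p) (lin 0 (h ⊞ 2 ⊠ ≤d) (solve (p ∷ s ∷ d ∷ f ∷ [])))

-- Structure of tight sets.

module _ {n} (G : SimpleGraph (Fin n)) where
  open SimpleGraph G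

  -- The reverse of the `HeavyForest` bound. It is asked of every induced forest in `S`, so that any
  -- forest of a smaller set, possibly with a vertex added, can be tested against it.
  Tight : ℕ → Subset n → Set
  Tight p S = ∀ F → F ⊆ S → IsForest (G [ F ]) →
    (3 + p) * (4 + p) * ∣ F ∣ + 2 * degreeSum G S ≤ 4 * (3 + p) * ∣ S ∣

  -- At q = 3 the line of the weight bound also has value 1 at degree 0, so isolated vertices are
  -- tight there as well.
  TightDegree : ℕ → ℕ → Set
  TightDegree p k = k ≡ 3 + p ⊎ k ≡ 2 + p ⊎ (p ≡ 0 × k ≡ 0)

  Transitive≢ : Subset n → Set
  Transitive≢ S = ∀ {u v w} → u ∈ S → v ∈ S → w ∈ S → u ~ v → v ~ w → u ≢ w → u ~ w

  Clustered : ℕ → Subset n → Set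
  Clustered p S = (∀ v → v ∈ S → TightDegree p (deg G S v)) × Transitive≢ S

  tight-remove : ∀ p {S v F} → v ∈ S → Tight p S → F ⊆ S → IsForest (G [ F ]) →
    (3 + p) * (4 + p) * ∣ F ∣ + 2 * (degreeSum G (S - v) + 2 * deg G S v) ≤ 4 * (3 + p) * suc ∣ S - v ∣
  tight-remove p {S} {v} {F} v∈S tight F⊆S forest =
    subst₂ _≤_ (cong (λ d → (3 + p) * (4 + p) * ∣ F ∣ + 2 * d) (degreeSum-remove G v∈S))
               (cong (4 * (3 + p) *_) (∣-∣ v∈S)) (tight F F⊆S forest)

  tight-delete : ∀ p {S v} → v ∈ S → 3 + p ≤ deg G S v → Tight p S → Tight p (S - v)
  tight-delete p {S} {v} v∈S q≤d tight F F⊆ forest =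
    tight-weight-delete p (∣ S - v ∣) (degreeSum G (S - v)) (∣ F ∣) (deg G S v) q≤d
      (tight-remove p v∈S tight (-⊆ {S = S} ∘ F⊆) forest)

  -- A heavy forest of `S - v` is also a forest of `S`, and a degree above q would make its
  -- inequality in `S` strict.
  tight-degree≤ : ∀ p {S v} → v ∈ S → Tight p S → deg G S v ≤ 3 + p
  tight-degree≤ p {S} {v} v∈S tight with F , F⊆ , forest , bound ← heavyForest G p (S - v) =
    tight-weight-degree p (∣ S - v ∣) (degreeSum G (S - v)) (∣ F ∣) (deg G S v) bound
      (tight-remove p v∈S tight (-⊆ {S = S} ∘ F⊆) forest)

  tight-insert : ∀ p {S v F} → v ∈ S → deg G S v ≤ 1 → Tight p S → F ⊆ S - v → IsForest (G [ F ]) →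
    (3 + p) * (4 + p) * suc ∣ F ∣ + 2 * (degreeSum G (S - v) + 2 * deg G S v) ≤ 4 * (3 + p) * suc ∣ S - v ∣
  tight-insert p {S} {v} {F} v∈S d≤1 tight F⊆ forest =
    subst (λ f → (3 + p) * (4 + p) * f + 2 * (degreeSum G (S - v) + 2 * deg G S v) ≤ 4 * (3 + p) * suc ∣ S - v ∣)
          (∣∪⁅⁆∣ v∉F)
          (tight-remove p v∈S tight (insert-⊆ v∈S (-⊆ {S = S} ∘ F⊆)) (IsForest-insert G (-⊆ {S = S} ∘ F⊆) v∉F d≤1 forest))
    where
    v∉F : v ∉ F
    v∉F = delete-∉ {S = S} F⊆

  -- Adding `v` to a heavy forest of `S - v` leaves the slack of `weight-insert`; tightness makes it
  -- 0, so both of its summands vanish.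
  tight-leaf : ∀ p {S v} → v ∈ S → deg G S v ≤ 1 → Tight p S → p ≡ 0 × deg G S v ≡ 0
  tight-leaf p {S} {v} v∈S d≤1 tight with F , F⊆ , forest , bound ← heavyForest G p (S - v) =
    m*n≡0⇒m≡0 p (3 + p) (m+n≡0⇒m≡0 _ slack≡0) , m+n≡0⇒m≡0 (deg G S v) (m+n≡0⇒n≡0 (p * (3 + p)) slack≡0)
    where
    slack≡0 : p * (3 + p) + 4 * deg G S v ≡ 0
    slack≡0 = n≤0⇒n≡0 (tight-weight-leaf p (∣ S - v ∣) (degreeSum G (S - v)) (∣ F ∣) (deg G S v) bound
      (tight-insert p v∈S d≤1 tight F⊆ forest))

  deg-remove-≁ : ∀ {S u v} → u ∈ S → ¬ u ~ v → deg G S v ≡ deg G (S - u) v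
  deg-remove-≁ {S} {u} {v} u∈S u≁v =
    trans (deg-remove G u∈S v) (trans (cong (deg G (S - u) v +_) (a-no G u≁v)) (+-identityʳ _))

  clustered-isolated : ∀ {S v} → v ∈ S → deg G S v ≡ 0 → Tight 0 S → (Tight 0 (S - v) → Clustered 0 (S - v)) → Clustered 0 S
  clustered-isolated {S} {v} v∈S d≡0 tight rec = degrees , transitive
    where
    tight′ : Tight 0 (S - v)
    -- Every forest of `S - v` can be extended by the isolated `v`, which adds 12 to both sides.
    tight′ F F⊆ forest = lin 0
      (subst (λ k → 12 * suc ∣ F ∣ + 2 * (degreeSum G (S - v) + 2 * k) ≤ 12 * suc ∣ S - v ∣) d≡0
        (tight-insert 0 v∈S (≤-trans (≤-reflexive d≡0) z≤n) tight F⊆ forest))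
      (arith (∣ S - v ∣) (∣ F ∣) (degreeSum G (S - v)))
      where
      arith : ∀ s f d → 12 * f + 2 * d + 12 * suc s + 0 ≡ 12 * s + (12 * suc f + 2 * (d + 2 * 0))
      arith = solve-∀
    ~⇒≢ : ∀ {u w} → u ∈ S → u ~ w → w ≢ v
    ~⇒≢ u∈S u~w refl = contradiction (deg≥1 G u∈S u~w) (<⇒≱ (s≤s (≤-reflexive d≡0)))
    degrees : ∀ w → w ∈ S → TightDegree 0 (deg G S w)
    degrees w w∈S with w ≟ v
    ... | yes refl = inj₂ (inj₂ (refl , d≡0))
    ... | no  w≢v  = subst (TightDegree 0) (sym (deg-remove-≁ v∈S λ v~w → ~⇒≢ w∈S (~-sym v~w) refl))
                       (proj₁ (rec tight′) w (x∈p∧x≢y⇒x∈p-y w∈S w≢v))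
    transitive : Transitive≢ S
    transitive u∈S x∈S w∈S u~x x~w = proj₂ (rec tight′)
      (x∈p∧x≢y⇒x∈p-y u∈S (~⇒≢ x∈S (~-sym u~x))) (x∈p∧x≢y⇒x∈p-y x∈S (~⇒≢ u∈S u~x))
      (x∈p∧x≢y⇒x∈p-y w∈S (~⇒≢ x∈S x~w)) u~x x~w

  clustered-2-regular : ∀ {S} → LowDegrees G 0 S → Tight 0 S → (∀ T → T ⊂ S → Tight 0 T → Clustered 0 T) → Clustered 0 S
  clustered-2-regular {S} (2≤d , d≤2) tight rec = (λ v v∈S → inj₂ (inj₁ (≤-antisym (d≤2 v v∈S) (2≤d v v∈S)))) , transitive
    where
    transitive : Transitive≢ S
    transitive {u} {v} {w} u∈S v∈S w∈S u~v v~w u≢w with u ~? w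
    ... | yes u~w = u~w
    ... | no  u≁w = contradiction (proj₁ (rec T ⊂S tight′) w w∈T) λ
      { (inj₁ d≡3) → contradiction (trans (sym d≡1) d≡3) λ ()
      ; (inj₂ (inj₁ d≡2)) → contradiction (trans (sym d≡1) d≡2) λ ()
      ; (inj₂ (inj₂ (_ , d≡0))) → contradiction (trans (sym d≡1) d≡0) λ () }
      where
      -- Here `u` is deleted first, leaving `v` with degree 1. The vertex `w` is adjacent to `v` but
      -- not to `u`, so it keeps exactly one neighbour in `T`.
      open DeleteEdge G 2≤d d≤2 u∈S v∈S (~-sym u~v) renaming (u∈S-v to v∈S-u; deg-u≡1 to deg-v≡1)
      T = S - u - v
      w∈T : w ∈ T
      w∈T = x∈p∧x≢y⇒x∈p-y (x∈p∧x≢y⇒x∈p-y w∈S (u≢w ∘ sym)) λ w≡v → ~-irr (sym w≡v) v~w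
      d≡1 : deg G T w ≡ 1
      d≡1 = suc-injective (trans (sym (deg-suc G v∈S-u v~w)) (trans (sym (deg-remove-≁ u∈S u≁w)) (deg≡2 w∈S)))
      tight′ : Tight 0 T
      tight′ F F⊆ forest = lin 0
        (subst₂ _≤_ (cong₂ (λ f d → 12 * f + 2 * d) (∣∪⁅⁆∣ v∉F) degreeSum-S) (cong (12 *_) size)
          (tight (F ∪ ⁅ v ⁆) (insert-⊆ v∈S (-⊆ {S = S} ∘ -⊆ {S = S - u} ∘ F⊆))
            (IsForest-insert G (-⊆ {S = S - u} ∘ F⊆) v∉F (≤-reflexive deg-v≡1) forest)))
        (arith (∣ T ∣) (∣ F ∣) (degreeSum G T))
        where
        v∉F : v ∉ F
        v∉F = delete-∉ {S = S - u} F⊆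
        arith : ∀ s f d → 12 * f + 2 * d + 12 * (2 + s) + 0 ≡ 12 * s + (12 * suc f + 2 * (d + 6))
        arith = solve-∀

  -- If `x` and `y` were the only possible neighbours of `v` in `S`, its degree would be at most the
  -- sum of their two indicators, which is 2.
  escape : ∀ {S v} → 3 ≤ deg G S v → ∀ x y → ∃ λ u → u ∈ S × u ~ v × u ≢ x × u ≢ y
  escape {S} {v} 3≤d x y with any? (λ u → u ∈? S ×-dec u ~? v ×-dec ¬? (u ≟ x) ×-dec ¬? (u ≟ y))
  ... | yes found = found
  ... | no  none  = contradiction 3≤d (<⇒≱ (s≤s (≤-trans (∑-mono bound) (≤-reflexive (begin
      ∑ (λ u → χ ⁅ x ⁆ u + χ ⁅ y ⁆ u) ≡⟨ Sums.∑-distrib-+ (χ ⁅ x ⁆) (χ ⁅ y ⁆) ⟩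
      ∑ (χ ⁅ x ⁆) + ∑ (χ ⁅ y ⁆)       ≡⟨ cong₂ _+_ (∣∣≡∑χ ⁅ x ⁆) (∣∣≡∑χ ⁅ y ⁆) ⟨
      ∣ ⁅ x ⁆ ∣ + ∣ ⁅ y ⁆ ∣           ≡⟨ cong₂ _+_ (∣⁅x⁆∣≡1 x) (∣⁅x⁆∣≡1 y) ⟩
      2                               ∎)))))
    where
    open ≡-Reasoning
    term≤1 : ∀ u → χ S u * a G u v ≤ 1
    term≤1 u with u ∈? S
    ... | yes u∈S = ≤-trans (≤-reflexive (trans (cong (_* a G u v) (χ-∈ u∈S)) (+-identityʳ _))) (a≤1 G u v)
    ... | no  u∉S = ≤-trans (≤-reflexive (cong (_* a G u v) (χ-∉ u∉S))) z≤n
    bound : ∀ u → χ S u * a G u v ≤ χ ⁅ x ⁆ u + χ ⁅ y ⁆ u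
    bound u = go (u ≟ x) (u ≟ y) (u ∈? S) (u ~? v)
      where
      go : Dec (u ≡ x) → Dec (u ≡ y) → Dec (u ∈ S) → Dec (u ~ v) → χ S u * a G u v ≤ χ ⁅ x ⁆ u + χ ⁅ y ⁆ u
      go (yes refl) _ _ _ = ≤-trans (term≤1 u) (≤-trans (≤-reflexive (sym (χ-∈ (x∈⁅x⁆ u)))) (m≤m+n _ _))
      go _ (yes refl) _ _ = ≤-trans (term≤1 u) (≤-trans (≤-reflexive (sym (χ-∈ (x∈⁅x⁆ u)))) (m≤n+m _ _))
      go (no u≢x) (no u≢y) (yes u∈S) (yes u~v) = contradiction (u , u∈S , u~v , u≢x , u≢y) none
      go _ _ (no u∉S) _ = ≤-trans (≤-reflexive (cong (_* a G u v) (χ-∉ u∉S))) z≤n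
      go _ _ _ (no u≁v) = ≤-trans (≤-reflexive (trans (cong (χ S u *_) (a-no G u≁v)) (*-zeroʳ (χ S u)))) z≤n

  clustered-heavy : ∀ p {S v} → v ∈ S → 3 + p ≤ deg G S v → Tight p S → (∀ T → T ⊂ S → Tight p T → Clustered p T) → Clustered p S
  clustered-heavy p {S} {v} v∈S q≤d tight rec = degrees , transitive
    where
    delete : ∀ {w} → w ∈ S → 3 + p ≤ deg G S w → Clustered p (S - w)
    delete {w} w∈S q≤d = rec (S - w) (x∈p⇒p-x⊂p w∈S) (tight-delete p w∈S q≤d tight)
    neighbour : ∀ {w} → w ∈ S → v ~ w → deg G S w ≡ 3 + p
    -- Restoring `v` raises the degree of `w` by one: degree q would become q + 1, above the
    -- maximum, and degree 0 would become 1, which `tight-leaf` forbids. Only q - 1 remains.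
    neighbour {w} w∈S v~w with proj₁ (delete v∈S q≤d) w (x∈p∧x≢y⇒x∈p-y w∈S λ w≡v → ~-irr (sym w≡v) v~w)
    ... | inj₁ d≡3+p = contradiction (tight-degree≤ p w∈S tight)
            (<⇒≱ (≤-reflexive (sym (trans (deg-suc G v∈S v~w) (cong suc d≡3+p)))))
    ... | inj₂ (inj₁ d≡2+p) = trans (deg-suc G v∈S v~w) (cong suc d≡2+p)
    ... | inj₂ (inj₂ (_ , d≡0)) = contradiction (proj₂ (tight-leaf p w∈S (≤-reflexive d≡1) tight)) λ d≡0 → contradiction (trans (sym d≡1) d≡0) λ ()
      where
      d≡1 : deg G S w ≡ 1
      d≡1 = trans (deg-suc G v∈S v~w) (cong suc d≡0)
    degrees : ∀ w → w ∈ S → TightDegree p (deg G S w)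
    degrees w w∈S with w ≟ v | v ~? w
    ... | yes refl | _       = inj₁ (≤-antisym (tight-degree≤ p w∈S tight) q≤d)
    ... | no _     | yes v~w = inj₁ (neighbour w∈S v~w)
    ... | no w≢v   | no v≁w  = subst (TightDegree p) (sym (deg-remove-≁ v∈S v≁w))
                                 (proj₁ (delete v∈S q≤d) w (x∈p∧x≢y⇒x∈p-y w∈S w≢v))
    -- If `v` is one of the three vertices, one of its at least three neighbours avoids the other
    -- two, and it has degree q by `neighbour`.
    avoid : ∀ x y z → ∃ λ w → w ∈ S × 3 + p ≤ deg G S w × x ≢ w × y ≢ w × z ≢ w
    avoid x y z = go (v ≟ x) (v ≟ y) (v ≟ z)
      where
      escape-v : ∀ s t → ∃ λ w → w ∈ S × 3 + p ≤ deg G S w × v ≢ w × s ≢ w × t ≢ w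
      escape-v s t with w , w∈S , w~v , w≢s , w≢t ← escape {S} {v} (≤-trans (m≤m+n 3 p) q≤d) s t =
        w , w∈S , ≤-reflexive (sym (neighbour w∈S (~-sym w~v))) , (λ v≡w → ~-irr (sym v≡w) w~v) , w≢s ∘ sym , w≢t ∘ sym
      go : Dec (v ≡ x) → Dec (v ≡ y) → Dec (v ≡ z) → ∃ λ w → w ∈ S × 3 + p ≤ deg G S w × x ≢ w × y ≢ w × z ≢ w
      go (yes refl) _ _ = escape-v y z
      go (no _) (yes refl) _ with w , w∈S , q≤ , v≢ , x≢ , z≢ ← escape-v x z = w , w∈S , q≤ , x≢ , v≢ , z≢
      go (no _) (no _) (yes refl) with w , w∈S , q≤ , v≢ , x≢ , y≢ ← escape-v x y = w , w∈S , q≤ , x≢ , y≢ , v≢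
      go (no v≢x) (no v≢y) (no v≢z) = v , v∈S , q≤d , v≢x ∘ sym , v≢y ∘ sym , v≢z ∘ sym
    transitive : Transitive≢ S
    transitive {x} {y} {z} x∈S y∈S z∈S with w , w∈S , q≤ , x≢w , y≢w , z≢w ← avoid x y z =
      -- Adjacency is that of the whole graph, so an edge found after deleting `w` is an edge
      -- between the same two vertices of `S`.
      proj₂ (delete w∈S q≤) (x∈p∧x≢y⇒x∈p-y x∈S x≢w) (x∈p∧x≢y⇒x∈p-y y∈S y≢w) (x∈p∧x≢y⇒x∈p-y z∈S z≢w)

  -- Tightness for 4 + p forces every degree to be 3 + p, and then `S` is tight for 3 + p as well;
  -- transitivity is taken from that smaller value.
  clustered-low : ∀ p {S} → (∀ v → v ∈ S → deg G S v ≤ 3 + p) → Tight (suc p) S → (Tight p S → Clustered p S) → Clustered (suc p) S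
  clustered-low p {S} d≤ tight rec with F , F⊆S , forest , bound ← heavyForest G p S =
    (λ v v∈S → inj₂ (inj₁ (regular G d≤ qs≤D v v∈S))) ,
    proj₂ (rec λ F F⊆S forest → tight-weight-pred p (∣ S ∣) (degreeSum G S) (∣ F ∣) (degreeSum-≤ G d≤) qs≤D (tight F F⊆S forest))
    where
    qs≤D : (3 + p) * ∣ S ∣ ≤ degreeSum G S
    qs≤D = tight-weight-regular p (∣ S ∣) (degreeSum G S) (∣ F ∣) bound (tight F F⊆S forest)

  clustered-induction : ∀ p → (∀ S → (∀ T → T ⊂ S → Tight p T → Clustered p T) → (∀ v → v ∈ S → deg G S v ≤ 2 + p) →
                          Tight p S → Clustered p S) → ∀ S → Acc _⊂_ S → Tight p S → Clustered p S
  clustered-induction p low S (acc rs) tight with any? (λ v → v ∈? S ×-dec 3 + p ≤? deg G S v)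
  ... | yes (v , v∈S , q≤d) = clustered-heavy p v∈S q≤d tight λ T T⊂S → clustered-induction p low T (rs T⊂S)
  ... | no q≰d = low S (λ T T⊂S → clustered-induction p low T (rs T⊂S))
                   (λ v v∈S → ≤-pred (≰⇒> λ q≤d → q≰d (v , v∈S , q≤d))) tight

  clustered-≤2 : ∀ S → (∀ T → T ⊂ S → Tight 0 T → Clustered 0 T) → (∀ v → v ∈ S → deg G S v ≤ 2) → Tight 0 S → Clustered 0 S
  clustered-≤2 S rec d≤2 tight with any? (λ v → v ∈? S ×-dec deg G S v ≤? 1)
  -- Degree 1 cannot occur in a tight set, so `v` is isolated.
  ... | yes (v , v∈S , d≤1) =
    clustered-isolated v∈S (proj₂ (tight-leaf 0 v∈S d≤1 tight)) tight (rec (S - v) (x∈p⇒p-x⊂p v∈S))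
  ... | no d≰1 = clustered-2-regular ((λ v v∈S → ≰⇒> λ d≤1 → d≰1 (v , v∈S , d≤1)) , d≤2) tight rec

  tight⇒clustered : ∀ p S → Tight p S → Clustered p S
  tight⇒clustered zero    S = clustered-induction 0 clustered-≤2 S (⊂-wellFounded S)
  tight⇒clustered (suc p) S =
    clustered-induction (suc p) (λ T _ d≤ tight → clustered-low p d≤ tight (tight⇒clustered p T)) S (⊂-wellFounded S)

-- The number of edges as half the degree sum.

∑≡sum-allFin : ∀ {n} (f : Fin n → ℕ) → sum (List.map f (List.allFin n)) ≡ ∑ f
∑≡sum-allFin f = trans (cong sum (map-tabulate (λ i → i) f)) (go f)
  where
  go : ∀ {n} (f : Fin n → ℕ) → sum (List.tabulate f) ≡ ∑ f
  go {zero}  f = refl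
  go {suc n} f = cong (f zero +_) (go (f ∘ suc))

length-filter-cartesianProduct : ∀ {A B : Set} {P : A × B → Set} (P? : ∀ z → Dec (P z)) (xs : List A) (ys : List B) →
  List.length (List.filter P? (List.cartesianProduct xs ys)) ≡
  sum (List.map (λ x → sum (List.map (λ y → 𝟙 (does (P? (x , y)))) ys)) xs)
length-filter-cartesianProduct P? []       ys = refl
length-filter-cartesianProduct P? (x ∷ xs) ys = begin
  List.length (List.filter P? (List.map (x ,_) ys List.++ rest))
    ≡⟨ cong List.length (filter-++ P? (List.map (x ,_) ys) rest) ⟩
  List.length (List.filter P? (List.map (x ,_) ys) List.++ List.filter P? rest)
    ≡⟨ length-++ (List.filter P? (List.map (x ,_) ys)) ⟩
  List.length (List.filter P? (List.map (x ,_) ys)) + List.length (List.filter P? rest)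
    ≡⟨ cong₂ _+_ (row ys) (length-filter-cartesianProduct P? xs ys) ⟩
  _ ∎
  where
  open ≡-Reasoning
  rest = List.cartesianProduct xs ys
  row : ∀ ys → List.length (List.filter P? (List.map (x ,_) ys)) ≡ sum (List.map (λ y → 𝟙 (does (P? (x , y)))) ys)
  row []       = refl
  row (y ∷ ys) with does (P? (x , y))
  ... | true  = cong suc (row ys)
  ... | false = row ys

-- Handshaking: `∣E∣` counts each edge once, from its smaller end, so `a u v` splits into
-- `e u v + e v u`, and exchanging the order of summation identifies the two double sums.
2*∣E∣≡degreeSum : ∀ {n} (G : SimpleGraph (Fin n)) → 2 * ∣E∣ G ≡ degreeSum G ⊤
2*∣E∣≡degreeSum {n} G = sym (begin
  ∑ (λ v → χ ⊤ v * deg G ⊤ v)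
    ≡⟨ Sums.sum-cong-≗ (λ v → χ⊤* v (deg G ⊤ v)) ⟩
  ∑ (λ v → ∑ λ u → χ ⊤ u * a G u v)
    ≡⟨ Sums.sum-cong-≗ (λ v → Sums.sum-cong-≗ λ u → trans (χ⊤* u (a G u v)) (a≡e+e u v)) ⟩
  ∑ (λ v → ∑ λ u → e u v + e v u)
    ≡⟨ Sums.sum-cong-≗ (λ v → Sums.∑-distrib-+ (λ u → e u v) (e v)) ⟩
  ∑ (λ v → ∑ (λ u → e u v) + ∑ (e v))
    ≡⟨ Sums.∑-distrib-+ (λ v → ∑ λ u → e u v) (λ v → ∑ (e v)) ⟩
  ∑ (λ v → ∑ (λ u → e u v)) + ∑ (λ v → ∑ (e v))
    ≡⟨ cong (_+ ∑ (λ v → ∑ (e v))) (Sums.∑-comm (λ v u → e u v)) ⟩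
  ∑ (λ v → ∑ (e v)) + ∑ (λ v → ∑ (e v))
    ≡⟨ cong₂ _+_ ∣E∣≡ (trans (+-identityʳ _) ∣E∣≡) ⟨
  2 * ∣E∣ G ∎)
  where
  open ≡-Reasoning
  open SimpleGraph G
  e : Fin n → Fin n → ℕ
  e u v = 𝟙 (does ((u Fin.<? v) ×-dec (u ~? v)))
  ∣E∣≡ : ∣E∣ G ≡ ∑ (λ v → ∑ (e v))
  ∣E∣≡ = trans (length-filter-cartesianProduct _ (List.allFin n) (List.allFin n))
    (trans (∑≡sum-allFin (λ u → sum (List.map (e u) (List.allFin n)))) (Sums.sum-cong-≗ λ u → ∑≡sum-allFin (e u)))
  χ⊤* : ∀ v k → χ (⊤ {n}) v * k ≡ k
  χ⊤* v k = trans (cong (_* k) (χ-∈ {S = ⊤} {v} ∈⊤)) (+-identityʳ k)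
  a≡e+e : ∀ u v → a G u v ≡ e u v + e v u
  a≡e+e u v with Fin.<-cmp u v
  ... | tri< u<v _ v≮u rewrite dec-true (u Fin.<? v) u<v | dec-false (v Fin.<? u) v≮u = sym (+-identityʳ _)
  ... | tri≈ u≮v refl _ rewrite dec-false (u Fin.<? u) u≮v = a-no G (~-irr refl)
  ... | tri> u≮v _ v<u rewrite dec-false (u Fin.<? v) u≮v | dec-true (v Fin.<? u) v<u = a-sym G u v

-- A closed form for `g`.

module _ (t : ℕ) .{{_ : NonZero t}} where

  -- Truncated subtraction is 0 below 2t, which merges the first two branches of `g`.
  g-low : ∀ n → n ≤ 4 * t → g n t ≡ 3 * (n ∸ 2 * t)
  g-low zero    _ = sym (cong (3 *_) (0∸n≡0 (2 * t)))
  g-low (suc m) n≤4t with suc m <? 2 * t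
  ... | yes n<2t rewrite dec-true (suc m <? 2 * t) n<2t = sym (cong (3 *_) (m≤n⇒m∸n≡0 (<⇒≤ n<2t)))
  ... | no  n≮2t rewrite dec-false (suc m <? 2 * t) n≮2t | dec-true (suc m ≤? 4 * t) n≤4t = refl

  g-step : ∀ m → 4 * t ≤ m → g (suc m) t ≡ g m t + ⌈ suc m / t ⌉ ∸ 1
  g-step m 4t≤m rewrite dec-false (suc m <? 2 * t) (≤⇒≯ (≤-trans (*-monoˡ-≤ t {2} {4} (s≤s (s≤s z≤n))) (m≤n⇒m≤1+n 4t≤m)))
                      | dec-false (suc m ≤? 4 * t) (<⇒≱ (s≤s 4t≤m)) = refl

  ⌈/⌉≡ : ∀ q r → r < t → ⌈ suc (q * t + r) / t ⌉ ≡ suc q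
  ⌈/⌉≡ q r r<t = begin
    (suc (q * t + r) + pred t) / t ≡⟨ cong (_/ t) (trans (arith (q * t) r (pred t)) (cong (λ s → r + (s + q * t)) (suc-pred t))) ⟩
    (r + suc q * t) / t            ≡⟨ +-distrib-/-∣ʳ r (n∣m*n (suc q)) ⟩
    r / t + (suc q * t) / t        ≡⟨ cong₂ _+_ (m<n⇒m/n≡0 r<t) (m*n/n≡m (suc q) t) ⟩
    suc q ∎
    where
    open ≡-Reasoning
    arith : ∀ x r s → suc (x + r) + s ≡ r + (suc s + x)
    arith = solve-∀

  -- The right side is twice the number of edges in `r` cliques on 5 + j and `t - r` cliques on 4 +
  -- j vertices. Allowing `r = t` gives multiples of `t` two representations, and this links the
  -- induction on `r` to the one on `j`.
  2*g≡ : ∀ j r → r ≤ t → 2 * g ((4 + j) * t + r) t ≡ (4 + j) * (3 + j) * t + 2 * (4 + j) * r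
  2*g≡ j (suc r) r<t = begin
    2 * g ((4 + j) * t + suc r) t     ≡⟨ cong (λ n → 2 * g n t) (+-suc ((4 + j) * t) r) ⟩
    2 * g (suc m) t                   ≡⟨ cong (2 *_) (g-step m (≤-trans (*-monoˡ-≤ t (m≤m+n 4 j)) (m≤m+n _ r))) ⟩
    2 * (g m t + ⌈ suc m / t ⌉ ∸ 1)   ≡⟨ cong (λ c → 2 * (g m t + c ∸ 1)) (⌈/⌉≡ (4 + j) r r<t) ⟩
    2 * (g m t + (5 + j) ∸ 1)         ≡⟨ cong (λ k → 2 * (k ∸ 1)) (+-suc (g m t) (4 + j)) ⟩
    2 * (g m t + (4 + j))             ≡⟨ *-distribˡ-+ 2 (g m t) (4 + j) ⟩
    2 * g m t + 2 * (4 + j)           ≡⟨ cong (_+ 2 * (4 + j)) (2*g≡ j r (<⇒≤ r<t)) ⟩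
    (4 + j) * (3 + j) * t + 2 * (4 + j) * r + 2 * (4 + j) ≡⟨ arith j r t ⟩
    (4 + j) * (3 + j) * t + 2 * (4 + j) * suc r ∎
    where
    open ≡-Reasoning
    m = (4 + j) * t + r
    arith : ∀ j r t → (4 + j) * (3 + j) * t + 2 * (4 + j) * r + 2 * (4 + j) ≡ (4 + j) * (3 + j) * t + 2 * (4 + j) * suc r
    arith = solve-∀
  2*g≡ (suc j) zero _ = begin
    2 * g ((5 + j) * t + 0) t   ≡⟨ cong (λ n → 2 * g n t) (trans (+-identityʳ _) (+-comm t _)) ⟩
    2 * g ((4 + j) * t + t) t   ≡⟨ 2*g≡ j t ≤-refl ⟩
    (4 + j) * (3 + j) * t + 2 * (4 + j) * t     ≡⟨ arith j t ⟩
    (5 + j) * (4 + j) * t + 2 * (5 + j) * 0 ∎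
    where
    open ≡-Reasoning
    arith : ∀ j t → (4 + j) * (3 + j) * t + 2 * (4 + j) * t ≡ (5 + j) * (4 + j) * t + 2 * (5 + j) * 0
    arith = solve-∀
  2*g≡ zero zero _ = begin
    2 * g (4 * t + 0) t              ≡⟨ cong (λ n → 2 * g n t) (+-identityʳ (4 * t)) ⟩
    2 * g (4 * t) t                  ≡⟨ cong (2 *_) (g-low (4 * t) ≤-refl) ⟩
    2 * (3 * (4 * t ∸ 2 * t))        ≡⟨ cong (λ k → 2 * (3 * k)) (*-distribʳ-∸ t 4 2) ⟨
    2 * (3 * (2 * t))                ≡⟨ arith t ⟩
    4 * 3 * t + 2 * 4 * 0 ∎
    where
    open ≡-Reasoning
    arith : ∀ t → 2 * (3 * (2 * t)) ≡ 4 * 3 * t + 2 * 4 * 0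
    arith = solve-∀

-- Subsets of given size, enumerations and isomorphisms.

subset-of-size : ∀ {n} (S : Subset n) {m} → m ≤ ∣ S ∣ → ∃ λ T → T ⊆ S × ∣ T ∣ ≡ m
subset-of-size {n} S {zero} _ = ⊥ , ⊥⊆ , ∣⊥∣≡0 n
subset-of-size (true  Vec.∷ S) {suc m} (s≤s m≤) with T , T⊆S , ∣T∣ ← subset-of-size S m≤ =
  true Vec.∷ T , s⊆s T⊆S , cong suc ∣T∣
subset-of-size (false Vec.∷ S) {suc m} m≤ with T , T⊆S , ∣T∣ ← subset-of-size S m≤ =
  false Vec.∷ T , s⊆s T⊆S , ∣T∣

-- The length `m` is a separate parameter, so that a known size can be substituted for `∣ S ∣`.
record Enumeration {n} (S : Subset n) (m : ℕ) : Set where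
  field
    enum      : Fin m → Fin n
    enum-∈    : ∀ i → enum i ∈ S
    injective : ∀ {i j} → enum i ≡ enum j → i ≡ j
    index     : ∀ {v} → v ∈ S → ∃ λ i → enum i ≡ v

enumerate : ∀ {n} (S : Subset n) → Enumeration S ∣ S ∣
enumerate Vec.[] = record { enum = λ () ; enum-∈ = λ () ; injective = λ { {()} } ; index = λ () }
enumerate (false Vec.∷ S) = record
  { enum      = suc ∘ enum
  ; enum-∈    = there ∘ enum-∈
  ; injective = injective ∘ Fin.suc-injective
  ; index     = λ { (there v∈S) → let i , eq = index v∈S in i , cong suc eq }
  }
  where open Enumeration (enumerate S)
enumerate (true Vec.∷ S) = record
  { enum      = λ { zero → zero ; (suc i) → suc (enum i) }
  ; enum-∈    = λ { zero → here ; (suc i) → there (enum-∈ i) }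
  ; injective = λ { {zero} {zero} _ → refl ; {suc i} {suc j} eq → cong suc (injective (Fin.suc-injective eq)) }
  ; index     = λ { here → zero , refl ; (there v∈S) → let i , eq = index v∈S in suc i , cong suc eq }
  }
  where open Enumeration (enumerate S)

parametrization⇒≅ : ∀ {V W} {G : SimpleGraph V} {H : SimpleGraph W} (let open SimpleGraph G renaming (_~_ to _~ᴳ_); open SimpleGraph H renaming (_~_ to _~ᴴ_)) (f : W → V) →
  (∀ {x y} → f x ≡ f y → x ≡ y) → (∀ v → ∃ λ x → f x ≡ v) →
  (∀ {x y} → x ~ᴴ y → f x ~ᴳ f y) → (∀ {x y} → f x ~ᴳ f y → x ~ᴴ y) → G ≅ H
parametrization⇒≅ {G = G} {H} f inj sur adj⇒ adj⇐ =
  mk↔ₛ′ (proj₁ ∘ sur) f (λ x → inj (proj₂ (sur (f x)))) (proj₂ ∘ sur) ,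
  λ u v → mk⇔ (λ u~v → adj⇐ (subst₂ (SimpleGraph._~_ G) (sym (proj₂ (sur u))) (sym (proj₂ (sur v))) u~v))
              (λ x~y → subst₂ (SimpleGraph._~_ G) (proj₂ (sur u)) (proj₂ (sur v)) (adj⇒ x~y))

-- Cliques and closed neighbourhoods.

module _ {n} (G : SimpleGraph (Fin n)) where
  open SimpleGraph G

  clique≅K : ∀ {C} → (∀ {u v} → u ∈ C → v ∈ C → u ≢ v → u ~ v) → G [ C ] ≅ K ∣ C ∣
  clique≅K {C} clique = parametrization⇒≅ {G = G [ C ]} {K ∣ C ∣} (λ i → enum i , enum-∈ i) (injective ∘ cong proj₁)
    (λ (v , v∈C) → let i , eq = index v∈C in i , ∃-≡ eq)
    (λ {i} {j} i≢j → clique (enum-∈ i) (enum-∈ j) (i≢j ∘ injective))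
    (λ u~v i≡j → ~-irr (cong enum i≡j) u~v)
    where open Enumeration (enumerate C)

  -- The closed neighbourhood; it is the component of `v` once adjacency is transitive on distinct
  -- vertices.
  N[_] : Fin n → Subset n
  N[ v ] = Vec.tabulate λ u → does ((u ≟ v) ⊎-dec (u ~? v))

  ∈N⁺ : ∀ {u v} → u ≡ v ⊎ u ~ v → u ∈ N[ v ]
  ∈N⁺ {u} {v} u≈v = lookup⇒[]= u N[ v ] (trans (lookup∘tabulate _ u) (dec-true ((u ≟ v) ⊎-dec (u ~? v)) u≈v))

  ∈N⁻ : ∀ {u v} → u ∈ N[ v ] → u ≡ v ⊎ u ~ v
  ∈N⁻ {u} {v} u∈N with (u ≟ v) ⊎-dec (u ~? v) in eq
  ... | yes u≈v = u≈v
  ... | no  _   = contradiction (trans (sym ([]=⇒lookup u∈N)) (trans (lookup∘tabulate _ u) (cong does eq))) λ ()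

  ∣N∣ : ∀ v → ∣ N[ v ] ∣ ≡ suc (deg G ⊤ v)
  ∣N∣ v = begin
    ∣ N[ v ] ∣                            ≡⟨ ∣∣≡∑χ N[ v ] ⟩
    ∑ (χ N[ v ])                          ≡⟨ Sums.sum-cong-≗ χN ⟩
    ∑ (λ u → χ ⁅ v ⁆ u + χ ⊤ u * a G u v) ≡⟨ Sums.∑-distrib-+ (χ ⁅ v ⁆) (λ u → χ ⊤ u * a G u v) ⟩
    ∑ (χ ⁅ v ⁆) + deg G ⊤ v               ≡⟨ cong (_+ deg G ⊤ v) (trans (sym (∣∣≡∑χ ⁅ v ⁆)) (∣⁅x⁆∣≡1 v)) ⟩
    suc (deg G ⊤ v)                       ∎
    where
    open ≡-Reasoning
    χN : ∀ u → χ N[ v ] u ≡ χ ⁅ v ⁆ u + χ ⊤ u * a G u v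
    χN u = go (u ≟ v) (u ~? v)
      where
      go : Dec (u ≡ v) → Dec (u ~ v) → χ N[ v ] u ≡ χ ⁅ v ⁆ u + χ ⊤ u * a G u v
      go (yes refl) _ = trans (χ-∈ (∈N⁺ (inj₁ refl))) (sym (cong₂ _+_ (χ-∈ (x∈⁅x⁆ u))
        (trans (cong (χ ⊤ u *_) (a-no G (~-irr refl))) (*-zeroʳ (χ ⊤ u)))))
      go (no u≢v) (yes u~v) = trans (χ-∈ (∈N⁺ (inj₂ u~v)))
        (sym (cong₂ _+_ (χ-∉ (x≢y⇒x∉⁅y⁆ u≢v)) (χ*a G {⊤} ∈⊤ u~v)))
      go (no u≢v) (no u≁v) = trans (χ-∉ λ u∈N → [ u≢v , u≁v ]′ (∈N⁻ u∈N))
        (sym (cong₂ _+_ (χ-∉ (x≢y⇒x∉⁅y⁆ u≢v)) (trans (cong (χ ⊤ u *_) (a-no G u≁v)) (*-zeroʳ (χ ⊤ u)))))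

-- Components of a graph with transitive adjacency.

module _ {n} (G : SimpleGraph (Fin n)) (transitive : Transitive≢ G ⊤) where
  open SimpleGraph G

  ~-trans : ∀ {u v w} → u ~ v → v ~ w → u ≢ w → u ~ w
  ~-trans = transitive ∈⊤ ∈⊤ ∈⊤

  star⇒≈ : ∀ {u v} → Star _~_ u v → u ≡ v ⊎ u ~ v
  star⇒≈ ε = inj₁ refl
  star⇒≈ {u} {v} (u~w ◅ path) with star⇒≈ path | u ≟ v
  ... | inj₁ refl | _       = inj₂ u~w
  ... | inj₂ w~v  | yes u≡v = inj₁ u≡v
  ... | inj₂ w~v  | no u≢v  = inj₂ (~-trans u~w w~v u≢v)

  component-size : ∀ {C u} → IsComponent G C → u ∈ C → ∣ C ∣ ≡ suc (deg G ⊤ u)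
  component-size {C} {u} (_ , class) u∈C = trans (cong ∣_∣ (⊆-antisym C⊆N N⊆C)) (∣N∣ G u)
    where
    C⊆N : C ⊆ N[_] G u
    C⊆N {v} v∈C = ∈N⁺ G ([ inj₁ ∘ sym , inj₂ ∘ ~-sym ]′ (star⇒≈ (Equivalence.to (class u u∈C v) v∈C)))
    N⊆C : N[_] G u ⊆ C
    N⊆C {v} v∈N with ∈N⁻ G v∈N
    ... | inj₁ refl = u∈C
    ... | inj₂ v~u  = Equivalence.from (class u u∈C v) (~-sym v~u ◅ ε)

  component≅K : ∀ {C} → IsComponent G C → G [ C ] ≅ K ∣ C ∣
  component≅K {C} (_ , class) = clique≅K G λ {u} {v} u∈C v∈C u≢v →
    [ (λ u≡v → contradiction u≡v u≢v) , (λ u~v → u~v) ]′ (star⇒≈ (Equivalence.to (class u u∈C v) v∈C))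

  N-clique : ∀ {v x y} → x ∈ N[_] G v → y ∈ N[_] G v → x ≢ y → x ~ y
  N-clique x∈N y∈N x≢y with ∈N⁻ G x∈N | ∈N⁻ G y∈N
  ... | inj₁ refl | inj₁ refl = contradiction refl x≢y
  ... | inj₁ refl | inj₂ y~v  = ~-sym y~v
  ... | inj₂ x~v  | inj₁ refl = x~v
  ... | inj₂ x~v  | inj₂ y~v  = ~-trans x~v (~-sym y~v) x≢y

  N-closed : ∀ {v x y} → x ∈ N[_] G v → x ~ y → y ∈ N[_] G v
  N-closed {v} {x} {y} x∈N x~y with ∈N⁻ G x∈N | y ≟ v
  ... | _         | yes y≡v = ∈N⁺ G (inj₁ y≡v)
  ... | inj₁ refl | no _    = ∈N⁺ G (inj₂ (~-sym x~y))
  ... | inj₂ x~v  | no y≢v  = ∈N⁺ G (inj₂ (~-trans (~-sym x~y) x~v y≢v))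

  -- Vertices of one class have the same closed neighbourhood, hence the same degree.
  deg-class : ∀ {u v} → u ∈ N[_] G v → deg G ⊤ u ≡ deg G ⊤ v
  deg-class {u} {v} u∈N = suc-injective (trans (sym (∣N∣ G u)) (trans (cong ∣_∣ (⊆-antisym ⊆Nv Nv⊆)) (∣N∣ G v)))
    where
    v∈Nu : v ∈ N[_] G u
    v∈Nu = ∈N⁺ G ([ inj₁ ∘ sym , inj₂ ∘ ~-sym ]′ (∈N⁻ G u∈N))
    ⊆-class : ∀ {x y} → x ∈ N[_] G y → N[_] G x ⊆ N[_] G y
    ⊆-class {y = y} x∈Ny {w} w∈Nx with ∈N⁻ G w∈Nx
    ... | inj₁ refl = x∈Ny
    ... | inj₂ w~x  = N-closed x∈Ny (~-sym w~x)
    ⊆Nv : N[_] G u ⊆ N[_] G v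
    ⊆Nv = ⊆-class u∈N
    Nv⊆ : N[_] G v ⊆ N[_] G u
    Nv⊆ = ⊆-class v∈Nu

  Closed : Subset n → Set
  Closed S = ∀ {u v} → u ∈ S → u ~ v → v ∈ S

  N⊆ : ∀ {S v} → Closed S → v ∈ S → N[_] G v ⊆ S
  N⊆ closed v∈S u∈N with ∈N⁻ G u∈N
  ... | inj₁ refl = v∈S
  ... | inj₂ u~v  = closed v∈S (~-sym u~v)

  Closed-─N : ∀ {S} v → Closed S → Closed (S ─ N[_] G v)
  Closed-─N {S} v closed {u} {w} u∈ u~w =
    x∈p∧x∉q⇒x∈p─q (closed (p─q⊆p S (N[_] G v) u∈) u~w) λ w∈N → ∈─⇒∉ {S = S} u∈ (N-closed w∈N (~-sym u~w))

  -- The sizes and their order are prescribed by `p`, so that a partition of all vertices is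
  -- literally a parametrization by the vertices of `⨆`.
  record CliquePartition (S : Subset n) {s} (p : Fin s → ℕ) : Set where
    field
      f      : ∀ i → Fin (p i) → Fin n
      f∈     : ∀ i x → f i x ∈ S
      f-inj  : ∀ i {x y} → f i x ≡ f i y → x ≡ y
      f-sur  : ∀ {v} → v ∈ S → ∃₂ λ i x → f i x ≡ v
      clique : ∀ i {x y} → x ≢ y → f i x ~ f i y
      apart  : ∀ i j {x y} → f i x ≡ f j y ⊎ f i x ~ f j y → i ≡ j

  partition-∷ : ∀ {S s v} {p : Fin (suc s) → ℕ} → Closed S → v ∈ S → ∣ N[_] G v ∣ ≡ p zero →
                CliquePartition (S ─ N[_] G v) (p ∘ suc) → CliquePartition S p
  partition-∷ {S} {s} {v} {p} closed v∈S size rest = record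
    { f      = λ { zero → enum ; (suc i) → R.f i }
    ; f∈     = λ { zero x → N⊆ closed v∈S (enum-∈ x) ; (suc i) x → p─q⊆p S N (R.f∈ i x) }
    ; f-inj  = λ { zero → injective ; (suc i) → R.f-inj i }
    ; f-sur  = λ {u} u∈S → sur u u∈S (u ∈? N)
    ; clique = λ { zero x≢y → N-clique (enum-∈ _) (enum-∈ _) (x≢y ∘ injective) ; (suc i) → R.clique i }
    ; apart  = λ
      { zero zero _ → refl
      ; zero (suc j) {x} {y} r → contradiction (meet (enum-∈ x) r) (∈─⇒∉ {S = S} (R.f∈ j y))
      ; (suc i) zero {x} {y} r → contradiction (meet (enum-∈ y) ([ inj₁ ∘ sym , inj₂ ∘ ~-sym ]′ r)) (∈─⇒∉ {S = S} (R.f∈ i x))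
      ; (suc i) (suc j) r → cong suc (R.apart i j r) }
    }
    where
    N = N[_] G v
    module R = CliquePartition rest
    open Enumeration (subst (Enumeration N) size (enumerate N))
    meet : ∀ {x y} → x ∈ N → x ≡ y ⊎ x ~ y → y ∈ N
    meet x∈N (inj₁ refl) = x∈N
    meet x∈N (inj₂ x~y)  = N-closed x∈N x~y
    sur : ∀ u → u ∈ S → Dec (u ∈ N) → ∃₂ λ i x → _ ≡ u
    sur u u∈S (yes u∈N) = let i , eq = index u∈N in zero , i , eq
    sur u u∈S (no u∉N)  = let i , x , eq = R.f-sur (x∈p∧x∉q⇒x∈p─q u∈S u∉N) in suc i , x , eq

  partition⇒≅ : ∀ {s} {p : Fin s → ℕ} → CliquePartition ⊤ p → G ≅ ⨆ λ i → K (p i)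
  partition⇒≅ {s} {p} P = parametrization⇒≅ {G = G} {⨆ λ i → K (p i)} (λ (i , x) → f i x) inj
    (λ v → let i , x , eq = f-sur {v} ∈⊤ in (i , x) , eq)
    (λ { (within {i} x≢y) → clique i x≢y }) adj
    where
    open CliquePartition P
    inj : ∀ {x y : Σ (Fin s) (Fin ∘ p)} → f (proj₁ x) (proj₂ x) ≡ f (proj₁ y) (proj₂ y) → x ≡ y
    inj {i , x} {j , y} eq with refl ← apart i j (inj₁ eq) = cong (i ,_) (f-inj i eq)
    adj : ∀ {x y : Σ (Fin s) (Fin ∘ p)} → f (proj₁ x) (proj₂ x) ~ f (proj₁ y) (proj₂ y) → ⨆-Adj (λ i → K (p i)) x y
    adj {i , x} {j , y} fx~fy with refl ← apart i j (inj₂ fx~fy) = within λ { refl → ~-irr refl fx~fy }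

-- Partition into cliques of two consecutive sizes.

module _ {n} (G : SimpleGraph (Fin n)) (transitive : Transitive≢ G ⊤)
         {k} {h : Fin n → ℕ} (deg≡ : ∀ v → deg G ⊤ v ≡ k + h v) (h≤1 : ∀ v → h v ≡ 0 ⊎ h v ≡ 1) where

  private N = N[_] G

  ∑-N : ∀ v → ∑ (λ u → χ (N v) u * h u) ≡ h v * ∣ N v ∣
  ∑-N v = trans (Sums.sum-cong-≗ term) (∑χ-const G (N v) (h v))
    where
    term : ∀ u → χ (N v) u * h u ≡ χ (N v) u * h v
    term u with u ∈? N v
    ... | yes u∈N = cong (χ (N v) u *_)
                      (+-cancelˡ-≡ k _ _ (trans (sym (deg≡ u)) (trans (deg-class G transitive u∈N) (deg≡ v))))
    ... | no  u∉N = trans (cong (_* h u) (χ-∉ u∉N)) (sym (cong (_* h v) (χ-∉ u∉N)))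

  ∣N∣≡ : ∀ {v b} → h v ≡ b → ∣ N v ∣ ≡ suc k + b
  ∣N∣≡ {v} h≡b = trans (∣N∣ G v) (cong suc (trans (deg≡ v) (cong (k +_) h≡b)))

  -- Closed neighbourhoods are split off one at a time, the `r` larger ones first, in the order
  -- fixed by `extra`. The sum of `h` counts the vertices in larger cliques: while `r` is positive
  -- it yields such a vertex, and at `r = 0` it excludes one.
  partition : ∀ s r S → r ≤ s → Closed G transitive S → ∣ S ∣ ≡ r + s * suc k → ∑ (λ v → χ S v * h v) ≡ r * (suc k + 1) →
              CliquePartition G transitive S {s} (λ i → suc k + extra r (toℕ i))
  partition zero zero S _ _ size _ = record
    { f = λ () ; f∈ = λ () ; f-inj = λ () ; clique = λ () ; apart = λ ()
    ; f-sur = λ v∈S → contradiction (trans (sym (∣-∣ v∈S)) size) λ () }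
  partition (suc s) zero S _ closed size heavy with nonempty? S
  ... | no empty = contradiction (trans (sym size) (trans (cong ∣_∣ (Empty-unique empty)) (∣⊥∣≡0 n))) λ ()
  ... | yes (v , v∈S) = partition-∷ G transitive closed v∈S (∣N∣≡ h≡0)
      (partition s zero (S ─ N v) z≤n (Closed-─N G transitive v closed) size′ heavy′)
    where
    h≡0 : h v ≡ 0
    h≡0 = m+n≡0⇒n≡0 (∑ (λ u → χ (S - v) u * h u)) (trans (sym (∑-remove {S = S} v∈S h)) heavy)
    N⊆S = N⊆ G transitive closed v∈S
    size′ : ∣ S ─ N v ∣ ≡ s * suc k
    size′ = +-cancelʳ-≡ (suc k + 0) _ _ (begin
      ∣ S ─ N v ∣ + (suc k + 0) ≡⟨ cong (∣ S ─ N v ∣ +_) (∣N∣≡ h≡0) ⟨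
      ∣ S ─ N v ∣ + ∣ N v ∣     ≡⟨ trans (sym (∣─∣ N⊆S)) size ⟩
      suc k + s * suc k         ≡⟨ trans (+-comm (suc k) (s * suc k)) (cong (s * suc k +_) (sym (+-identityʳ _))) ⟩
      s * suc k + (suc k + 0)   ∎)
      where open ≡-Reasoning
    heavy′ : ∑ (λ u → χ (S ─ N v) u * h u) ≡ 0
    heavy′ = m+n≡0⇒m≡0 _ (trans (sym (∑-─ {S = S} N⊆S h)) heavy)
  partition (suc s) (suc r) S (s≤s r≤s) closed size heavy with any? (λ v → v ∈? S ×-dec h v ℕ.≟ 1)
  ... | no none = contradiction (trans (sym heavy) (∑-zero light)) λ ()
    where
    light : ∀ v → χ S v * h v ≡ 0
    light v with v ∈? S | h≤1 v
    ... | no v∉S  | _        = cong (_* h v) (χ-∉ v∉S)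
    ... | yes _   | inj₁ h≡0 = trans (cong (χ S v *_) h≡0) (*-zeroʳ (χ S v))
    ... | yes v∈S | inj₂ h≡1 = contradiction (v , v∈S , h≡1) none
  ... | yes (v , v∈S , h≡1) = partition-∷ G transitive closed v∈S (∣N∣≡ h≡1)
      (partition s r (S ─ N v) r≤s (Closed-─N G transitive v closed) size′ heavy′)
    where
    N⊆S = N⊆ G transitive closed v∈S
    size′ : ∣ S ─ N v ∣ ≡ r + s * suc k
    size′ = +-cancelʳ-≡ (suc k + 1) _ _ (begin
      ∣ S ─ N v ∣ + (suc k + 1)       ≡⟨ cong (∣ S ─ N v ∣ +_) (∣N∣≡ h≡1) ⟨
      ∣ S ─ N v ∣ + ∣ N v ∣           ≡⟨ trans (sym (∣─∣ N⊆S)) size ⟩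
      suc r + (suc k + s * suc k)     ≡⟨ solve (r ∷ s ∷ k ∷ []) ⟩
      r + s * suc k + (suc k + 1)     ∎)
      where open ≡-Reasoning
    heavy′ : ∑ (λ u → χ (S ─ N v) u * h u) ≡ r * (suc k + 1)
    heavy′ = +-cancelʳ-≡ (suc k + 1) _ _ (begin
      ∑ (λ u → χ (S ─ N v) u * h u) + (suc k + 1)
        ≡⟨ cong (∑ (λ u → χ (S ─ N v) u * h u) +_) ∑-N≡ ⟨
      ∑ (λ u → χ (S ─ N v) u * h u) + ∑ (λ u → χ (N v) u * h u)
        ≡⟨ trans (sym (∑-─ {S = S} N⊆S h)) heavy ⟩
      suc r * (suc k + 1)
        ≡⟨ +-comm (suc k + 1) (r * (suc k + 1)) ⟩
      r * (suc k + 1) + (suc k + 1) ∎)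
      where
      open ≡-Reasoning
      ∑-N≡ : ∑ (λ u → χ (N v) u * h u) ≡ suc k + 1
      ∑-N≡ = trans (∑-N v) (trans (cong₂ _*_ h≡1 (∣N∣≡ h≡1)) (+-identityʳ _))

degreeSum-⊤ : ∀ {n} (G : SimpleGraph (Fin n)) {k} (h : Fin n → ℕ) → (∀ v → deg G ⊤ v ≡ k + h v) →
              degreeSum G ⊤ ≡ k * n + ∑ (λ v → χ (⊤ {n}) v * h v)
degreeSum-⊤ {n} G {k} h deg≡ = begin
  ∑ (λ v → χ S v * deg G ⊤ v)
    ≡⟨ Sums.sum-cong-≗ (λ v → trans (cong (χ S v *_) (deg≡ v)) (*-distribˡ-+ (χ S v) k (h v))) ⟩
  ∑ (λ v → χ S v * k + χ S v * h v)
    ≡⟨ Sums.∑-distrib-+ (λ v → χ S v * k) (λ v → χ S v * h v) ⟩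
  ∑ (λ v → χ S v * k) + ∑ (λ v → χ S v * h v)
    ≡⟨ cong (_+ ∑ (λ v → χ S v * h v)) (trans (∑χ-const G S k) (cong (k *_) (∣⊤∣≡n n))) ⟩
  k * n + ∑ (λ v → χ S v * h v) ∎
  where
  open ≡-Reasoning
  S = ⊤ {n}

-- Comparison with `g` and the theorem.

low-bound : ∀ n t f e → f ≤ 2 * t → 12 * n ≤ 12 * f + 2 * (2 * e) → 3 * n ≤ 3 * (2 * t) + e
low-bound n t f e f≤ h = *-cancelˡ-≤ 4 (lin 0 (12 ⊠ f≤ ⊞ h) (solve (n ∷ t ∷ f ∷ e ∷ [])))

low-tight : ∀ t f x → f ≤ 2 * t → 12 * f + 2 * (2 * (3 * x)) ≤ 12 * (2 * t + x)
low-tight t f x f≤ = lin 0 (12 ⊠ f≤) (solve (t ∷ f ∷ x ∷ []))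

high-bound : ∀ j r t f e g → f ≤ 2 * t → 2 * g ≡ (4 + j) * (3 + j) * t + 2 * (4 + j) * r →
             4 * (4 + j) * ((4 + j) * t + r) ≤ (4 + j) * (5 + j) * f + 2 * (2 * e) → g ≤ e
high-bound j r t f e g f≤ g≡ h = *-cancelˡ-≤ 4
  (lin 0 (h ⊞ (4 + j) * (5 + j) ⊠ f≤ ⊞ 2 ⊠ ≤-reflexive g≡) (solve (j ∷ r ∷ t ∷ f ∷ e ∷ g ∷ [])))

high-tight : ∀ j r t f g → f ≤ 2 * t → 2 * g ≡ (4 + j) * (3 + j) * t + 2 * (4 + j) * r →
             (4 + j) * (5 + j) * f + 2 * (2 * g) ≤ 4 * (4 + j) * ((4 + j) * t + r)
high-tight j r t f g f≤ g≡ =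
  lin 0 ((4 + j) * (5 + j) ⊠ f≤ ⊞ 2 ⊠ ≤-reflexive g≡) (solve (j ∷ r ∷ t ∷ f ∷ g ∷ []))

module Extremal (n t : ℕ) .{{_ : NonZero t}} (G : SimpleGraph (Fin n))
                (noForest : (S : Subset n) → ∣ S ∣ ≡ 2 * t + 1 → ¬ IsForest (G [ S ])) where
  open SimpleGraph G

  -- The hypothesis concerns exactly 2t + 1 vertices, so a larger forest is first cut down to that
  -- size.
  forest≤ : ∀ F → IsForest (G [ F ]) → ∣ F ∣ ≤ 2 * t
  forest≤ F forest = ≮⇒≥ λ 2t<F →
    let T , T⊆F , ∣T∣ = subset-of-size F (subst (_≤ ∣ F ∣) (+-comm 1 (2 * t)) 2t<F)
    in noForest T ∣T∣ (IsForest-⊆ G T⊆F forest)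

  -- The equations allow callers to write 4 + j for 3 + suc j.
  weighted-forest : ∀ p {q q′} → 3 + p ≡ q → 4 + p ≡ q′ →
                    ∃ λ f → f ≤ 2 * t × 4 * q * n ≤ q * q′ * f + 2 * (2 * ∣E∣ G)
  weighted-forest p refl refl with F , _ , forest , bound ← heavyForest G p ⊤ =
    ∣ F ∣ , forest≤ F forest ,
    subst₂ (λ s d → 4 * (3 + p) * s ≤ (3 + p) * (4 + p) * ∣ F ∣ + 2 * d) (∣⊤∣≡n n) (sym (2*∣E∣≡degreeSum G)) bound

  tight⊤ : ∀ p {q q′} → 3 + p ≡ q → 4 + p ≡ q′ →
           ((F : Subset n) → ∣ F ∣ ≤ 2 * t → q * q′ * ∣ F ∣ + 2 * (2 * ∣E∣ G) ≤ 4 * q * n) → Tight G p ⊤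
  tight⊤ p refl refl bound F _ forest =
    subst₂ (λ s d → (3 + p) * (4 + p) * ∣ F ∣ + 2 * d ≤ 4 * (3 + p) * s) (sym (∣⊤∣≡n n)) (2*∣E∣≡degreeSum G)
      (bound F (forest≤ F forest))

  module Low (n≤4t : n ≤ 4 * t) where

    g≤∣E∣ : g n t ≤ ∣E∣ G
    g≤∣E∣ with f , f≤ , bound ← weighted-forest 0 refl refl = begin
      g n t               ≡⟨ g-low t n n≤4t ⟩
      3 * (n ∸ 2 * t)     ≡⟨ *-distribˡ-∸ 3 n (2 * t) ⟩
      3 * n ∸ 3 * (2 * t) ≤⟨ m≤n+o⇒m∸n≤o (3 * n) (3 * (2 * t)) (low-bound n t f (∣E∣ G) f≤ bound) ⟩
      ∣E∣ G               ∎
      where open ≤-Reasoning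

    clustered : ∣E∣ G ≡ g n t → Clustered G 0 ⊤
    clustered eq = tight⇒clustered G 0 ⊤ (tight⊤ 0 refl refl λ F f≤ →
      subst (λ e → 12 * ∣ F ∣ + 2 * (2 * e) ≤ 12 * n) (sym (trans eq (g-low t n n≤4t))) (bound F f≤))
      where
      bound : ∀ F → ∣ F ∣ ≤ 2 * t → 12 * ∣ F ∣ + 2 * (2 * (3 * (n ∸ 2 * t))) ≤ 12 * n
      bound F f≤ with ≤-total n (2 * t)
      -- Here `g` is 0 and the bound 2t is too weak; a forest has at most `n` vertices.
      ... | inj₁ n≤2t rewrite m≤n⇒m∸n≡0 n≤2t =
        ≤-trans (≤-reflexive (+-identityʳ (12 * ∣ F ∣))) (*-monoʳ-≤ 12 (∣p∣≤n F))
      ... | inj₂ 2t≤n = subst (λ m → 12 * ∣ F ∣ + 2 * (2 * (3 * (n ∸ 2 * t))) ≤ 12 * m) (m+[n∸m]≡n 2t≤n)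
        (low-tight t (∣ F ∣) (n ∸ 2 * t) f≤)

    components : ∣E∣ G ≡ g n t → (C : Subset n) → IsComponent G C → (G [ C ] ≅ K 1) ⊎ (G [ C ] ≅ K 3) ⊎ (G [ C ] ≅ K 4)
    components eq C component@((u , u∈C) , _) with degrees , transitive ← clustered eq =
      -- The tight degrees 3, 2 and 0 give the cliques on 4, 3 and 1 vertices.
      [ inj₂ ∘ inj₂ ∘ C≅K , [ inj₂ ∘ inj₁ ∘ C≅K , inj₁ ∘ C≅K ∘ proj₂ ]′ ]′ (degrees u ∈⊤)
      where
      C≅K : ∀ {d} → deg G ⊤ u ≡ d → G [ C ] ≅ K (suc d)
      C≅K d≡ = subst (λ m → G [ C ] ≅ K m) (trans (component-size G transitive component u∈C) (cong suc d≡))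
        (component≅K G transitive component)

  module High (j : ℕ) (n/t≡ : n / t ≡ 4 + j) where

    r : ℕ
    r = n % t

    r≤t : r ≤ t
    r≤t = <⇒≤ (m%n<n n t)

    n≡ : n ≡ (4 + j) * t + r
    n≡ = trans (m≡m%n+[m/n]*n n t) (trans (+-comm r (n / t * t)) (cong (λ q → q * t + r) n/t≡))

    2*g : 2 * g n t ≡ (4 + j) * (3 + j) * t + 2 * (4 + j) * r
    2*g = trans (cong (λ m → 2 * g m t) n≡) (2*g≡ t j r r≤t)

    g≤∣E∣ : g n t ≤ ∣E∣ G
    -- With p = suc j, the parameter q is 4 + j, the quotient `n / t`.
    g≤∣E∣ = let f , f≤ , bound = weighted-forest (suc j) {4 + j} {5 + j} refl refl in
      high-bound j r t f (∣E∣ G) (g n t) f≤ 2*g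
        (subst (λ m → 4 * (4 + j) * m ≤ (4 + j) * (5 + j) * f + 2 * (2 * ∣E∣ G)) n≡ bound)

    clustered : ∣E∣ G ≡ g n t → Clustered G (suc j) ⊤
    clustered eq = tight⇒clustered G (suc j) ⊤ (tight⊤ (suc j) {4 + j} {5 + j} refl refl λ F f≤ →
      subst₂ (λ e m → (4 + j) * (5 + j) * ∣ F ∣ + 2 * (2 * e) ≤ 4 * (4 + j) * m) (sym eq) (sym n≡)
        (high-tight j r t (∣ F ∣) (g n t) f≤ 2*g))

    clustered⇒≅ : ∣E∣ G ≡ g n t → Clustered G (suc j) ⊤ → G ≅ G⟨ n , t ⟩
    clustered⇒≅ eq (degrees , transitive) = partition⇒≅ G transitive
      (subst (λ q → CliquePartition G transitive ⊤ {t} (λ i → q + extra r (toℕ i))) (sym n/t≡)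
        (partition G transitive {3 + j} {h} deg≡ h≤1 t r ⊤ r≤t (λ _ _ → ∈⊤) size heavy))
      where
      h : Fin n → ℕ
      h v = deg G ⊤ v ∸ (3 + j)
      deg-cases : ∀ v → deg G ⊤ v ≡ 3 + j ⊎ deg G ⊤ v ≡ 4 + j
      -- The isolated case requires p = 0, which is impossible for p = suc j.
      deg-cases v with degrees v ∈⊤
      ... | inj₁ d≡4+j        = inj₂ d≡4+j
      ... | inj₂ (inj₁ d≡3+j) = inj₁ d≡3+j
      h≤1 : ∀ v → h v ≡ 0 ⊎ h v ≡ 1
      h≤1 v with deg-cases v
      ... | inj₁ d≡ = inj₁ (trans (cong (_∸ (3 + j)) d≡) (n∸n≡0 (3 + j)))
      ... | inj₂ d≡ = inj₂ (trans (cong (_∸ (3 + j)) d≡) (m+n∸n≡m 1 (3 + j)))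
      deg≡ : ∀ v → deg G ⊤ v ≡ 3 + j + h v
      deg≡ v = sym (m+[n∸m]≡n ([ (λ d≡ → ≤-reflexive (sym d≡)) , (λ d≡ → ≤-trans (n≤1+n (3 + j)) (≤-reflexive (sym d≡))) ]′ (deg-cases v)))
      size : ∣ ⊤ {n} ∣ ≡ r + t * (4 + j)
      size = trans (∣⊤∣≡n n) (trans n≡ (trans (+-comm ((4 + j) * t) r) (cong (r +_) (*-comm (4 + j) t))))
      H = ∑ (λ v → χ (⊤ {n}) v * h v)
      heavy : H ≡ r * (4 + j + 1)
      -- Equality fixes the degree sum at `2 * g n t`; subtracting 3 + j for each of the `n`
      -- vertices leaves r (5 + j), the number of vertices in `r` cliques on 5 + j vertices.
      heavy = +-cancelˡ-≡ ((3 + j) * ((4 + j) * t + r)) _ _ (begin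
        (3 + j) * ((4 + j) * t + r) + H ≡⟨ cong (λ m → (3 + j) * m + H) n≡ ⟨
        (3 + j) * n + H                 ≡⟨ degreeSum-⊤ G h deg≡ ⟨
        degreeSum G ⊤                   ≡⟨ 2*∣E∣≡degreeSum G ⟨
        2 * ∣E∣ G                       ≡⟨ trans (cong (2 *_) eq) 2*g ⟩
        (4 + j) * (3 + j) * t + 2 * (4 + j) * r ≡⟨ arith j t r ⟩
        (3 + j) * ((4 + j) * t + r) + r * (4 + j + 1) ∎)
        where
        open ≡-Reasoning
        arith : ∀ j t r → (4 + j) * (3 + j) * t + 2 * (4 + j) * r ≡ (3 + j) * ((4 + j) * t + r) + r * (4 + j + 1)
        arith = solve-∀

    ≅G⟨n,t⟩ : ∣E∣ G ≡ g n t → G ≅ G⟨ n , t ⟩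
    ≅G⟨n,t⟩ eq = clustered⇒≅ eq (clustered eq)

  4≤n/t : 4 * t ≤ n → n / t ≡ 4 + (n / t ∸ 4)
  4≤n/t 4t≤n = sym (m+[n∸m]≡n (≤-trans (≤-reflexive (sym (m*n/n≡m 4 t))) (/-monoˡ-≤ t 4t≤n)))

  g≤∣E∣ : g n t ≤ ∣E∣ G
  g≤∣E∣ = [ Low.g≤∣E∣ , (λ 4t≤n → High.g≤∣E∣ (n / t ∸ 4) (4≤n/t 4t≤n)) ]′ (≤-total n (4 * t))

theorem4p1 : (n t : ℕ) .{{_ : NonZero n}} .{{_ : NonZero t}} (G : SimpleGraph (Fin n)) →
    ((S : Subset n) → ∣ S ∣ ≡ 2 * t + 1 → ¬ IsForest (G [ S ])) →
    (g n t ≤ ∣E∣ G)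
    × (∣E∣ G ≡ g n t → n < 4 * t → (C : Subset n) → IsComponent G C →
    (G [ C ] ≅ K 1) ⊎ (G [ C ] ≅ K 3) ⊎ (G [ C ] ≅ K 4))
    × (∣E∣ G ≡ g n t → 4 * t ≤ n → G ≅ G⟨ n , t ⟩)
theorem4p1 n t G noForest =
  g≤∣E∣ ,
  (λ eq n<4t → Low.components (<⇒≤ n<4t) eq) ,
  (λ eq 4t≤n → High.≅G⟨n,t⟩ (n / t ∸ 4) (4≤n/t 4t≤n) eq)
  where open Extremal n t G noForest
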